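{- Let $m\geq 4$ be even, $n=2^m-1$, and let $i_1,i_2\in\{0,1,2,3\}$ with $i_1-i_2\equiv 1 \pmod 2$. Let $\mathcal{C}=\mathcal{C}_{i_1,i_2}$ be the binary $[n,n-m-1,3]$ code with parity check matrix $H_m(\mathbf{v}_{i_1,i_2})$ (defined in the context). Then the automorphism group $\mathrm{Aut}(\mathcal{C})$ is isomorphic to the symplectic group $Sp(m,2)$, and its order is \[ |\mathrm{Aut}(\mathcal{C})| = (2^m-1)\cdot 2^{m-1}\cdot (2^{m-2}-1)\cdot 2^{m-3}\cdots (2^2-1)\cdot 2 \;=\;\prod_{j=1}^{m/2}(2^{2j}-1)\,2^{2j-1}. \]
   Context: $\mathbb{F}_2$ is the binary field. Let $m\ge 4$ be even and $n=2^m-1$. Let $\alpha$ be a primitive element of $GF(2^m)$ and let $H_m$ be the $m\times n$ binary matrix whose $i$-th column $\mathbf{h}_i$ ($i=0,\dots,n-1$) is the coordinate vector of $\alpha^i$ with respect to the basis $1,\alpha,\dots,\alpha^{m-1}$; thus the columns of $H_m$ are exactly the nonzero vectors of $\mathbb{F}_2^m$, and $H_m$ is a parity check matrix of the binary Hamming code $\mathcal{H}_m$. For distinct $i_1,i_2\in\{0,1,2,3\}$ let $\mathbf{v}_{i_1,i_2}=(v_0,\dots,v_{n-1})$ where $v_i=1$ if the Hamming weight $\mathrm{wt}(\mathbf{h}_i)\equiv i_1$ or $i_2 \pmod 4$, and $v_i=0$ otherwise. $H_m(\mathbf{v}_{i_1,i_2})$ is the $(m+1)\times n$ matrix obtained from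 $H_m$ by appending the row $\mathbf{v}_{i_1,i_2}$, and $\mathcal{C}_{i_1,i_2}=\{\mathbf{c}\in\mathbb{F}_2^n: H_m(\mathbf{v}_{i_1,i_2})\mathbf{c}^T=\mathbf{0}\}$. The automorphism group $\mathrm{Aut}(\mathcal{C})$ of a binary code $\mathcal{C}$ of length $n$ is the group of permutations of the $n$ coordinate positions mapping $\mathcal{C}$ into itself. $Sp(m,2)$ is the group of nonsingular $m\times m$ binary matrices preserving a nondegenerate alternating (symplectic) bilinear form on $\mathbb{F}_2^m$. -}

module Defs where

open import Data.Bool using (Bool; true; false; _xor_; _∧_; _∨_; if_then_else_)
open import Data.Nat using (ℕ; zero; suc; _+_; _*_; _∸_; _^_; _%_; _≡ᵇ_)
open import Data.Fin using (Fin; toℕ) renaming (zero to fzero; suc to fsuc)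
import Data.Fin as F
open import Data.Product using (Σ; _×_; _,_; proj₁; proj₂; ∃)
open import Relation.Binary.PropositionalEquality using (_≡_)
open import Relation.Nullary using (¬_; does)
open import Function using (_∘_)
open import Function.Definitions using (Injective)

-- Basic linear algebra over F₂ = Bool (xor = +, ∧ = ·)

⨁ : ∀ {n} → (Fin n → Bool) → Bool
⨁ {zero}  f = false
⨁ {suc n} f = f fzero xor ⨁ (f ∘ fsuc)

BVec : ℕ → Set
BVec m = Fin m → Bool

IsZeroVec : ∀ {m} → BVec m → Set
IsZeroVec x = ∀ r → x r ≡ false

weight : ∀ {m} → BVec m → ℕ
weight {zero}  x = 0
weight {suc m} x = (if x fzero then 1 else 0) + weight (x ∘ fsuc)

Mat : ℕ → Set
Mat m = Fin m → Fin m → Bool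

_⊛_ : ∀ {m} → Mat m → Mat m → Mat m
(A ⊛ B) i j = ⨁ (λ k → A i k ∧ B k j)

idMat : ∀ {m} → Mat m
idMat i j = does (i F.≟ j)

_≈M_ : ∀ {m} → Mat m → Mat m → Set
A ≈M B = ∀ i j → A i j ≡ B i j

apply : ∀ {m} → Mat m → BVec m → BVec m
apply A x i = ⨁ (λ j → A i j ∧ x j)

Nonsingular : ∀ {m} → Mat m → Set
Nonsingular {m} A = Σ (Mat m) λ A' → ((A ⊛ A') ≈M idMat) × ((A' ⊛ A) ≈M idMat)

bil : ∀ {m} → Mat m → BVec m → BVec m → Bool
bil G x y = ⨁ (λ i → ⨁ (λ j → x i ∧ G i j ∧ y j))

Alternating : ∀ {m} → Mat m → Set
Alternating G = ∀ x → bil G x x ≡ false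

Nondegenerate : ∀ {m} → Mat m → Set
Nondegenerate G = ∀ x → (∀ y → bil G x y ≡ false) → IsZeroVec x

PreservesForm : ∀ {m} → Mat m → Mat m → Set
PreservesForm G A = ∀ x y → bil G (apply A x) (apply A y) ≡ bil G x y

Sp : ∀ {m} → Mat m → Set
Sp {m} G = Σ (Mat m) λ A → Nonsingular A × PreservesForm G A

_≈Sp_ : ∀ {m} {G : Mat m} → Sp G → Sp G → Set
a ≈Sp b = proj₁ a ≈M proj₁ b

-- The Hamming parity-check matrix: a column map h : Fin n → F₂^m whose
-- columns are exactly the nonzero vectors of F₂^m (each exactly once).

IsHammingColumns : ∀ {m n} → (Fin n → BVec m) → Set
IsHammingColumns {m} {n} h =
    (∀ i → ¬ IsZeroVec (h i))
  × (∀ i j → (∀ r → h i r ≡ h j r) → i ≡ j)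
  × (∀ (x : BVec m) → ¬ IsZeroVec x → Σ (Fin n) λ i → ∀ r → h i r ≡ x r)

vRow : ∀ {m n} → (Fin n → BVec m) → Fin 4 → Fin 4 → BVec n
vRow h i₁ i₂ i =
  ((weight (h i) % 4) ≡ᵇ toℕ i₁) ∨ ((weight (h i) % 4) ≡ᵇ toℕ i₂)

InCode : ∀ {m n} → (Fin n → BVec m) → Fin 4 → Fin 4 → BVec n → Set
InCode h i₁ i₂ c =
    (∀ r → ⨁ (λ i → h i r ∧ c i) ≡ false)
  × (⨁ (λ i → vRow h i₁ i₂ i ∧ c i) ≡ false)

-- Automorphism group of C: permutations σ of the coordinates
-- (injective self-maps of Fin n) with c ∈ C ⇒ c ∘ σ ∈ C.

Aut : ∀ {m n} → (Fin n → BVec m) → Fin 4 → Fin 4 → Set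
Aut {m} {n} h i₁ i₂ =
  Σ (Fin n → Fin n) λ σ →
    Injective _≡_ _≡_ σ × (∀ c → InCode h i₁ i₂ c → InCode h i₁ i₂ (c ∘ σ))

_≈Aut_ : ∀ {m n} {h : Fin n → BVec m} {i₁ i₂} → Aut h i₁ i₂ → Aut h i₁ i₂ → Set
a ≈Aut b = ∀ i → proj₁ a i ≡ proj₁ b i

_∘Aut_ : ∀ {m n} {h : Fin n → BVec m} {i₁ i₂} → Aut h i₁ i₂ → Aut h i₁ i₂ → Aut h i₁ i₂
(σ , σi , σc) ∘Aut (τ , τi , τc) = (σ ∘ τ) , (λ eq → τi (σi eq)) , (λ c cc → τc (c ∘ σ) (σc c cc))

record AutIsoSp {m n} (h : Fin n → BVec m) (i₁ i₂ : Fin 4) (G : Mat m) : Set where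
  field
    to       : Aut h i₁ i₂ → Sp G
    from     : Sp G → Aut h i₁ i₂
    to-cong  : ∀ a b → a ≈Aut b → to a ≈Sp to b
    from-cong : ∀ a b → a ≈Sp b → from a ≈Aut from b
    to-from  : ∀ s → to (from s) ≈Sp s
    from-to  : ∀ a → from (to a) ≈Aut a
    homo     : ∀ a b → proj₁ (to (a ∘Aut b)) ≈M (proj₁ (to a) ⊛ proj₁ (to b))

HasCard : (A : Set) → (A → A → Set) → ℕ → Set
HasCard A _≈_ N =
  Σ (Fin N → A) λ f → Σ (A → Fin N) λ g →
    (∀ k → g (f k) ≡ k) × (∀ a → f (g a) ≈ a) × (∀ a b → a ≈ b → g a ≡ g b)

spOrder : ℕ → ℕ
spOrder zero    = 1
spOrder (suc k) = spOrder k * ((2 ^ (2 * suc k) ∸ 1) * 2 ^ (2 * k + 1))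

{-# OPTIONS --safe #-}
module Submission where

-- The last row of the parity check matrix is a quadratic form q, up to a
-- constant, with nondegenerate polar form Γ(x , y) = Σ_{i ≠ j} x_i y_j (m even).
-- An automorphism permutes the rows' span, so it acts on the columns by
-- x ↦ L x + q(x) a; a collision argument forces a = 0, and then L preserves q
-- up to a linear form, hence preserves Γ. Conversely an isometry of Γ changes
-- q by a linear form and preserves the span. So Aut(C) is the isometry group
-- of Γ; all nondegenerate alternating forms in dimension 2k are equivalent,
-- and the isometries of the standard one are counted by the image of its first
-- hyperbolic pair, the stabiliser of that pair being the group for k - 1.

open import Defs
open import Data.Nat using (ℕ; _+_; _*_; _∸_; _^_; _%_; _≤_)
open import Data.Fin using (Fin; toℕ)
open import Data.Product using (_×_)
open import Relation.Binary.PropositionalEquality using (_≡_)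
open import Algebra using (CommutativeRing)
import Algebra.Properties.Semiring.Sum as SemiringSum
open import Data.Bool using (Bool; true; false; not; _xor_; _∧_; _∨_; if_then_else_)
import Data.Bool.Properties as 𝔹
open import Data.Bool.Solver using (module xor-∧-Solver)
import Data.Fin as Fin
open import Data.Fin.Patterns using (0F; 1F; 2F; 3F)
import Data.Fin.Properties as Fin
open import Data.Nat as ℕ using (zero; suc; _<_)
open import Data.Nat.DivMod using (%-distribˡ-+)
import Data.Nat.Properties as ℕ
open import Data.Product using (Σ; _,_; proj₁; proj₂; ∃; ∃₂)
open import Data.Product.Function.NonDependent.Setoid using (_×-inverse_)
import Data.Product.Relation.Binary.Pointwise.NonDependent as ×
open import Data.Sum using (_⊎_; inj₁; inj₂)
open import Data.Vec using (Vec; []; _∷_; zipWith; replicate; lookup; tabulate)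
import Data.Vec.Properties as Vec
open import Function using (_∘_; id; _↔_; mk↔ₛ′; Inverse)
import Function.Construct.Composition as Comp
import Function.Construct.Symmetry as Symm
open import Function.Definitions using (Injective)
open import Level using (0ℓ)
open import Relation.Binary using (Setoid)
open import Relation.Binary.PropositionalEquality
  using (refl; sym; trans; cong; cong₂; subst; setoid; module ≡-Reasoning)
open import Relation.Nullary using (¬_; Dec; yes; no; does; contradiction)

open xor-∧-Solver using (solve; _:+_; _:*_; _:=_; con)

-- The zero vector shapes the argument. It is not a column, so a permutation of the columns says
-- nothing about it, while `q` may well be one there (when 0 is among `i₁`, `i₂`). The formulas for
-- permuted rows therefore hold on nonzero vectors only, and the constant `q 𝟎` has to be carried
-- through every polarisation.
--
-- Two degenerate possibilities must be excluded: a nonzero translation part a, and an image of the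
-- last row in which `q` no longer occurs. Either one contradicts the existence of vectors outside
-- {0, d} with a prescribed pairing with a nonzero vector d. Both values of the pairing are
-- available there only in dimension above 2, and this is how the bound 4 ≤ m enters.
--
-- An automorphism sends c to `c ∘ σ`, so dually it composes rows with the inverse permutation; the
-- linear map is found for the inverse first and inverted at the end.

infixl 6 _⊕_
infixr 7 _·_

-- `Vec Bool` is used in place of the function type `BVec`: equality of vectors is then
-- propositional and decidable, whereas functions would require extensionality.
_⊕_ : ∀ {n} → Vec Bool n → Vec Bool n → Vec Bool n
_⊕_ = zipWith _xor_

𝟎 : ∀ {n} → Vec Bool n
𝟎 = replicate _ false

_·_ : ∀ {n} → Bool → Vec Bool n → Vec Bool n
true  · x = x
false · x = 𝟎

⊕-assoc : ∀ {n} (x y z : Vec Bool n) → (x ⊕ y) ⊕ z ≡ x ⊕ (y ⊕ z)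
⊕-assoc = Vec.zipWith-assoc 𝔹.xor-assoc

⊕-comm : ∀ {n} (x y : Vec Bool n) → x ⊕ y ≡ y ⊕ x
⊕-comm = Vec.zipWith-comm 𝔹.xor-comm

⊕-identityˡ : ∀ {n} (x : Vec Bool n) → 𝟎 ⊕ x ≡ x
⊕-identityˡ = Vec.zipWith-identityˡ 𝔹.xor-identityˡ

⊕-identityʳ : ∀ {n} (x : Vec Bool n) → x ⊕ 𝟎 ≡ x
⊕-identityʳ = Vec.zipWith-identityʳ 𝔹.xor-identityʳ

⊕-self : ∀ {n} (x : Vec Bool n) → x ⊕ x ≡ 𝟎
⊕-self []      = refl
⊕-self (b ∷ x) = cong₂ _∷_ (𝔹.xor-same b) (⊕-self x)

⊕-cancelˡ : ∀ {n} (x y : Vec Bool n) → x ⊕ (x ⊕ y) ≡ y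
⊕-cancelˡ x y = trans (sym (⊕-assoc x x y)) (trans (cong (_⊕ y) (⊕-self x)) (⊕-identityˡ y))

⊕-cancelʳ : ∀ {n} (x y : Vec Bool n) → (x ⊕ y) ⊕ y ≡ x
⊕-cancelʳ x y = trans (⊕-assoc x y y) (trans (cong (x ⊕_) (⊕-self y)) (⊕-identityʳ x))

⊕-medial : ∀ {n} (w x y z : Vec Bool n) → (w ⊕ x) ⊕ (y ⊕ z) ≡ (w ⊕ y) ⊕ (x ⊕ z)
⊕-medial w x y z = begin
  (w ⊕ x) ⊕ (y ⊕ z) ≡⟨ ⊕-assoc w x (y ⊕ z) ⟩
  w ⊕ (x ⊕ (y ⊕ z)) ≡⟨ cong (w ⊕_) (⊕-assoc x y z) ⟨
  w ⊕ ((x ⊕ y) ⊕ z) ≡⟨ cong (λ t → w ⊕ (t ⊕ z)) (⊕-comm x y) ⟩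
  w ⊕ ((y ⊕ x) ⊕ z) ≡⟨ cong (w ⊕_) (⊕-assoc y x z) ⟩
  w ⊕ (y ⊕ (x ⊕ z)) ≡⟨ ⊕-assoc w y (x ⊕ z) ⟨
  (w ⊕ y) ⊕ (x ⊕ z) ∎
  where open ≡-Reasoning

⊕-≡𝟎 : ∀ {n} {x y : Vec Bool n} → x ⊕ y ≡ 𝟎 → x ≡ y
⊕-≡𝟎 {x = x} {y} eq = trans (sym (⊕-cancelʳ x y)) (trans (cong (_⊕ y) eq) (⊕-identityˡ y))

xor-≡ : ∀ {a b} → a xor b ≡ false → a ≡ b
xor-≡ {true}  {true}  _ = refl
xor-≡ {false} {false} _ = refl

infix 4 _≟ᵥ_
_≟ᵥ_ : ∀ {n} (x y : Vec Bool n) → Dec (x ≡ y)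
_≟ᵥ_ = Vec.≡-dec 𝔹._≟_

lookup-⊕ : ∀ {n} (x y : Vec Bool n) i → lookup (x ⊕ y) i ≡ lookup x i xor lookup y i
lookup-⊕ x y i = Vec.lookup-zipWith _xor_ i x y

lookup-𝟎 : ∀ {n} (i : Fin n) → lookup 𝟎 i ≡ false
lookup-𝟎 i = Vec.lookup-replicate i false

lookup-· : ∀ {n} b (x : Vec Bool n) i → lookup (b · x) i ≡ b ∧ lookup x i
lookup-· true  x i = refl
lookup-· false x i = lookup-𝟎 i

lookup-ext : ∀ {n} {x y : Vec Bool n} → (∀ i → lookup x i ≡ lookup y i) → x ≡ y
lookup-ext {x = x} {y} eq =
  trans (sym (Vec.tabulate∘lookup x)) (trans (Vec.tabulate-cong eq) (Vec.tabulate∘lookup y))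

·-xor : ∀ {n} a b (x : Vec Bool n) → (a xor b) · x ≡ a · x ⊕ b · x
·-xor true  true  x = sym (⊕-self x)
·-xor true  false x = sym (⊕-identityʳ x)
·-xor false b     x = sym (⊕-identityˡ (b · x))

-- Additive maps are the linear ones, as the scalars are F₂.
Additive : ∀ {n m} → (Vec Bool n → Vec Bool m) → Set
Additive f = ∀ x y → f (x ⊕ y) ≡ f x ⊕ f y

Functional : ∀ {n} → (Vec Bool n → Bool) → Set
Functional ℓ = ∀ x y → ℓ (x ⊕ y) ≡ ℓ x xor ℓ y

additive-𝟎 : ∀ {n m} (f : Vec Bool n → Vec Bool m) → Additive f → f 𝟎 ≡ 𝟎
additive-𝟎 f add = begin
  f 𝟎         ≡⟨ cong f (⊕-identityˡ 𝟎) ⟨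
  f (𝟎 ⊕ 𝟎)   ≡⟨ add 𝟎 𝟎 ⟩
  f 𝟎 ⊕ f 𝟎   ≡⟨ ⊕-self (f 𝟎) ⟩
  𝟎           ∎
  where open ≡-Reasoning

functional-𝟎 : ∀ {n} (ℓ : Vec Bool n → Bool) → Functional ℓ → ℓ 𝟎 ≡ false
functional-𝟎 ℓ add =
  trans (cong ℓ (sym (⊕-identityˡ 𝟎))) (trans (add 𝟎 𝟎) (𝔹.xor-same (ℓ 𝟎)))

additive-· : ∀ {n m} (f : Vec Bool n → Vec Bool m) → Additive f → ∀ b x → f (b · x) ≡ b · f x
additive-· f add true  x = refl
additive-· f add false x = additive-𝟎 f add

functional-· : ∀ {n} (ℓ : Vec Bool n → Bool) → Functional ℓ → ∀ b x → ℓ (b · x) ≡ b ∧ ℓ x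
functional-· ℓ add true  x = refl
functional-· ℓ add false x = functional-𝟎 ℓ add

-- Sums over F₂.

⨁-cong : ∀ {n} {f g : Fin n → Bool} → (∀ i → f i ≡ g i) → ⨁ f ≡ ⨁ g
⨁-cong {zero}  eq = refl
⨁-cong {suc n} eq = cong₂ _xor_ (eq Fin.zero) (⨁-cong (eq ∘ Fin.suc))

private
  module Sum = SemiringSum (CommutativeRing.semiring 𝔹.xor-∧-commutativeRing)

⨁≡sum : ∀ {n} (f : Fin n → Bool) → ⨁ f ≡ Sum.sum f
⨁≡sum {zero}  f = refl
⨁≡sum {suc n} f = cong (f Fin.zero xor_) (⨁≡sum (f ∘ Fin.suc))

⨁-xor : ∀ {n} (f g : Fin n → Bool) → ⨁ (λ i → f i xor g i) ≡ ⨁ f xor ⨁ g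
⨁-xor f g = trans (⨁≡sum (λ i → f i xor g i)) (trans (Sum.∑-distrib-+ f g) (sym (cong₂ _xor_ (⨁≡sum f) (⨁≡sum g))))

⨁-∧ˡ : ∀ {n} b (f : Fin n → Bool) → ⨁ (λ i → b ∧ f i) ≡ b ∧ ⨁ f
⨁-∧ˡ b f = trans (⨁≡sum (λ i → b ∧ f i)) (trans (sym (Sum.*-distribˡ-sum b f)) (cong (b ∧_) (sym (⨁≡sum f))))

⨁-comm : ∀ {n m} (f : Fin n → Fin m → Bool) →
         ⨁ (λ i → ⨁ (λ j → f i j)) ≡ ⨁ (λ j → ⨁ (λ i → f i j))
⨁-comm f = begin
  ⨁ (λ i → ⨁ (λ j → f i j))             ≡⟨ ⨁-cong (λ i → ⨁≡sum (f i)) ⟩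
  ⨁ (λ i → Sum.sum (λ j → f i j))       ≡⟨ ⨁≡sum (λ i → Sum.sum (λ j → f i j)) ⟩
  Sum.sum (λ i → Sum.sum (λ j → f i j)) ≡⟨ Sum.∑-comm f ⟩
  Sum.sum (λ j → Sum.sum (λ i → f i j)) ≡⟨ ⨁≡sum (λ j → Sum.sum (λ i → f i j)) ⟨
  ⨁ (λ j → Sum.sum (λ i → f i j))       ≡⟨ ⨁-cong (λ j → ⨁≡sum (λ i → f i j)) ⟨
  ⨁ (λ j → ⨁ (λ i → f i j))             ∎
  where open ≡-Reasoning

⨁-permute : ∀ {n} (f : Fin n → Bool) (π : Fin n ↔ Fin n) → ⨁ f ≡ ⨁ (f ∘ Inverse.to π)
⨁-permute f π = trans (⨁≡sum f) (trans (Sum.sum-permute f π) (sym (⨁≡sum (f ∘ Inverse.to π))))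

⨁-false : ∀ {n} → ⨁ {n} (λ _ → false) ≡ false
⨁-false {zero}  = refl
⨁-false {suc n} = ⨁-false {n}

⨁-δ : ∀ {n} (f : Fin n → Bool) j → ⨁ (λ i → f i ∧ does (i Fin.≟ j)) ≡ f j
⨁-δ {suc m} f Fin.zero = begin
  (f Fin.zero ∧ true) xor ⨁ (λ i → f (Fin.suc i) ∧ false)
    ≡⟨ cong₂ _xor_ (𝔹.∧-identityʳ (f Fin.zero)) (trans (⨁-cong (λ i → 𝔹.∧-zeroʳ (f (Fin.suc i)))) (⨁-false {m})) ⟩
  f Fin.zero xor false
    ≡⟨ 𝔹.xor-identityʳ (f Fin.zero) ⟩
  f Fin.zero ∎
  where open ≡-Reasoning
⨁-δ f (Fin.suc j) rewrite 𝔹.∧-zeroʳ (f Fin.zero) = ⨁-δ (f ∘ Fin.suc) j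

-- Expansion of functionals in the standard basis.

basis : ∀ {n} → Fin n → Vec Bool n
basis Fin.zero    = true ∷ 𝟎
basis (Fin.suc i) = false ∷ basis i

lookup-basis : ∀ {n} (i j : Fin n) → lookup (basis j) i ≡ does (i Fin.≟ j)
lookup-basis Fin.zero    Fin.zero    = refl
lookup-basis Fin.zero    (Fin.suc j) = refl
lookup-basis (Fin.suc i) Fin.zero    = lookup-𝟎 i
lookup-basis (Fin.suc i) (Fin.suc j) = lookup-basis i j

functional-expand : ∀ {n} (ℓ : Vec Bool n → Bool) → Functional ℓ → ∀ x →
                    ℓ x ≡ ⨁ (λ s → lookup x s ∧ ℓ (basis s))
functional-expand ℓ add [] = functional-𝟎 ℓ add
functional-expand ℓ add (b ∷ x) = begin
  ℓ (b ∷ x)                       ≡⟨ cong ℓ (split b) ⟩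
  ℓ (b · (true ∷ 𝟎) ⊕ (false ∷ x)) ≡⟨ add _ _ ⟩
  ℓ (b · (true ∷ 𝟎)) xor ℓ (false ∷ x)
    ≡⟨ cong₂ _xor_ (functional-· ℓ add b (true ∷ 𝟎)) (functional-expand (ℓ ∘ (false ∷_)) (λ y z → add (false ∷ y) (false ∷ z)) x) ⟩
  _ ∎
  where
  open ≡-Reasoning
  split : ∀ b → b ∷ x ≡ b · (true ∷ 𝟎) ⊕ (false ∷ x)
  split true  = cong (true ∷_) (sym (⊕-identityˡ x))
  split false = cong (false ∷_) (sym (⊕-identityˡ x))

functional-lookup : ∀ {n m} (f : Vec Bool n → Vec Bool m) → Additive f → ∀ i → Functional (λ x → lookup (f x) i)
functional-lookup f add i x y = trans (cong (λ z → lookup z i) (add x y)) (lookup-⊕ (f x) (f y) i)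

functional-sum : ∀ {n m} (g : Fin n → Vec Bool m → Bool) → (∀ i → Functional (g i)) →
                 Functional (λ x → ⨁ (λ i → g i x))
functional-sum g add x y = trans (⨁-cong (λ i → add i x y)) (⨁-xor (λ i → g i x) (λ i → g i y))

-- Counting arguments on finite vector spaces.

vec↔fin : ∀ n → Vec Bool n ↔ Fin (2 ^ n)
vec↔fin zero = mk↔ₛ′ (λ _ → Fin.zero) (λ _ → []) (λ { Fin.zero → refl ; (Fin.suc ()) }) (λ { [] → refl })
vec↔fin (suc n) = mk↔ₛ′ enc dec enc-dec dec-enc
  where
  open Inverse
  enc : Vec Bool (suc n) → Fin (2 ^ suc n)
  enc (b ∷ x) = Fin.combine (from Fin.2↔Bool b) (to (vec↔fin n) x)
  unpair : Fin 2 × Fin (2 ^ n) → Vec Bool (suc n)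
  unpair (c , i) = to Fin.2↔Bool c ∷ from (vec↔fin n) i
  dec : Fin (2 ^ suc n) → Vec Bool (suc n)
  dec i = unpair (Fin.remQuot (2 ^ n) i)
  enc-dec : ∀ i → enc (dec i) ≡ i
  enc-dec i = let c , j = Fin.remQuot {2} (2 ^ n) i in trans
    (cong₂ Fin.combine (strictlyInverseʳ Fin.2↔Bool c) (strictlyInverseˡ (vec↔fin n) j))
    (Fin.combine-remQuot {2} (2 ^ n) i)
  dec-enc : ∀ x → dec (enc x) ≡ x
  dec-enc (b ∷ x) = trans
    (cong unpair (Fin.remQuot-combine (from Fin.2↔Bool b) (to (vec↔fin n) x)))
    (cong₂ _∷_ (strictlyInverseˡ Fin.2↔Bool b) (strictlyInverseʳ (vec↔fin n) x))

collision : ∀ {m n} → m < n → (f : Vec Bool n → Vec Bool m) → ∃₂ λ x y → ¬ x ≡ y × f x ≡ f y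
collision {m} {n} m<n f =
  let i , j , i<j , eq = Fin.pigeonhole (ℕ.^-monoʳ-< 2 (ℕ.s≤s (ℕ.s≤s ℕ.z≤n)) m<n) (to (vec↔fin m) ∘ f ∘ from (vec↔fin n))
  in from (vec↔fin n) i , from (vec↔fin n) j
   , (λ e → Fin.<⇒≢ i<j (from-injective e))
   , to-injective eq
  where
  open Inverse
  from-injective : ∀ {i j} → from (vec↔fin n) i ≡ from (vec↔fin n) j → i ≡ j
  from-injective e = trans (sym (strictlyInverseˡ (vec↔fin n) _)) (trans (cong (to (vec↔fin n)) e) (strictlyInverseˡ (vec↔fin n) _))
  to-injective : ∀ {x y} → to (vec↔fin m) x ≡ to (vec↔fin m) y → x ≡ y
  to-injective e = trans (sym (strictlyInverseʳ (vec↔fin m) _)) (trans (cong (from (vec↔fin m)) e) (strictlyInverseʳ (vec↔fin m) _))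

abstract
  -- Plays the part of rank and nullity: two vectors with the same image differ by an element of the
  -- kernel. The witnesses in this block come from exhaustive search; `abstract` keeps them from
  -- unfolding, and only their properties are used.
  kernel : ∀ {m n} → m < n → (f : Vec Bool n → Vec Bool m) → Additive f → ∃ λ z → ¬ z ≡ 𝟎 × f z ≡ 𝟎
  kernel m<n f add =
    let x , y , x≢y , eq = collision m<n f
    in x ⊕ y , x≢y ∘ ⊕-≡𝟎 , trans (add x y) (trans (cong (_⊕ f y) eq) (⊕-self (f y)))

  -- A missed value y could be punched out of the codomain, leaving an injection of `Fin (suc n)`
  -- into `Fin n`.
  fin-surjective : ∀ {n} (f : Fin n → Fin n) → Injective _≡_ _≡_ f → ∀ y → ∃ λ x → f x ≡ y
  fin-surjective {suc n} f inj y with Fin.any? (λ x → f x Fin.≟ y)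
  ... | yes found = found
  ... | no none   = contradiction
    (λ {i} {j} e → inj (Fin.punchOut-injective (y≢ i) (y≢ j) e))
    (Fin.<⇒notInjective {f = λ x → Fin.punchOut (y≢ x)} (ℕ.n<1+n n))
    where
    y≢ : ∀ x → ¬ y ≡ f x
    y≢ x e = none (x , sym e)

  vec-surjective : ∀ {n} (f : Vec Bool n → Vec Bool n) → Injective _≡_ _≡_ f → ∀ y → ∃ λ x → f x ≡ y
  vec-surjective {n} f inj y =
    let i , eq = fin-surjective (to E ∘ f ∘ from E)
                   (λ e → trans (sym (strictlyInverseˡ E _)) (trans (cong (to E) (inj (enc-injective e))) (strictlyInverseˡ E _)))
                   (to E y)
    in from E i , enc-injective eq
    where
    open Inverse
    E : Vec Bool n ↔ Fin (2 ^ n)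
    E = vec↔fin n
    enc-injective : ∀ {x y} → to E x ≡ to E y → x ≡ y
    enc-injective e = trans (sym (strictlyInverseʳ E _)) (trans (cong (from E) e) (strictlyInverseʳ E _))

  -- Takes the place of excluded middle: nondegeneracy is given as an implication with a universal
  -- premise, and searching the finite space turns it into the witness that `B-dual` asks for.
  search : ∀ {n} (p : Vec Bool n → Bool) → (∃ λ x → p x ≡ true) ⊎ (∀ x → p x ≡ false)
  search {zero} p with p [] in eq
  ... | true  = inj₁ ([] , eq)
  ... | false = inj₂ λ { [] → eq }
  search {suc n} p with search (p ∘ (true ∷_)) | search (p ∘ (false ∷_))
  ... | inj₁ (x , eq) | _             = inj₁ (true ∷ x , eq)
  ... | inj₂ _        | inj₁ (x , eq) = inj₁ (false ∷ x , eq)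
  ... | inj₂ t        | inj₂ f        = inj₂ λ { (true ∷ x) → t x ; (false ∷ x) → f x }

-- Symplectic spaces and the standard form.

record Symplectic (n : ℕ) : Set where
  field
    B      : Vec Bool n → Vec Bool n → Bool
    B-⊕ˡ   : ∀ x y z → B (x ⊕ y) z ≡ B x z xor B y z
    B-sym  : ∀ x y → B x y ≡ B y x
    B-alt  : ∀ x → B x x ≡ false
    -- Nondegeneracy in positive form: each nonzero vector comes with a partner, from which
    -- hyperbolic pairs are built.
    B-dual : ∀ x → ¬ x ≡ 𝟎 → ∃ λ y → B x y ≡ true

  B-⊕ʳ : ∀ x y z → B x (y ⊕ z) ≡ B x y xor B x z
  B-⊕ʳ x y z = trans (B-sym x _) (trans (B-⊕ˡ y z x) (cong₂ _xor_ (B-sym y x) (B-sym z x)))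

  B-𝟎ˡ : ∀ y → B 𝟎 y ≡ false
  B-𝟎ˡ y = functional-𝟎 (λ x → B x y) (λ x z → B-⊕ˡ x z y)

  B-𝟎ʳ : ∀ x → B x 𝟎 ≡ false
  B-𝟎ʳ x = functional-𝟎 (B x) (B-⊕ʳ x)

  B-·ˡ : ∀ b x y → B (b · x) y ≡ b ∧ B x y
  B-·ˡ b x y = functional-· (λ x → B x y) (λ x z → B-⊕ˡ x z y) b x

  B-·ʳ : ∀ x b y → B x (b · y) ≡ b ∧ B x y
  B-·ʳ x = functional-· (B x) (B-⊕ʳ x)

  -- Nondegeneracy as an extensionality principle: linearity of isometries and adjoints is proved by
  -- testing against all z.
  B-separates : ∀ {x y} → (∀ z → B x z ≡ B y z) → x ≡ y
  B-separates {x} {y} eq with x ⊕ y ≟ᵥ 𝟎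
  ... | yes e = ⊕-≡𝟎 e
  ... | no ne = let z , Bz = B-dual (x ⊕ y) ne in contradiction
    (trans (sym Bz) (trans (B-⊕ˡ x y z) (trans (cong (_xor B y z) (eq z)) (𝔹.xor-same (B y z)))))
    λ ()

  B≡true⇒≢𝟎 : ∀ {x y} → B x y ≡ true → ¬ y ≡ 𝟎
  B≡true⇒≢𝟎 {x} eq refl = contradiction (trans (sym eq) (B-𝟎ʳ x)) λ ()

  B≡true⇒≢ : ∀ {x y} → B x y ≡ true → ¬ y ≡ x
  B≡true⇒≢ {x} eq refl = contradiction (trans (sym eq) (B-alt x)) λ ()

open Symplectic using (B)

-- The coordinates come as adjacent hyperbolic pairs, e before f. With the dimension written
-- `k * 2`, `suc k * 2` reduces to two successors and matching peels off one pair.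
Ω : ∀ k → Vec Bool (k * 2) → Vec Bool (k * 2) → Bool
Ω zero    []          []          = false
Ω (suc k) (a ∷ b ∷ x) (c ∷ d ∷ y) = ((a ∧ d) xor (b ∧ c)) xor Ω k x y

Ω-⊕ˡ : ∀ k x y z → Ω k (x ⊕ y) z ≡ Ω k x z xor Ω k y z
Ω-⊕ˡ zero    []          []            []          = refl
Ω-⊕ˡ (suc k) (a ∷ b ∷ x) (a' ∷ b' ∷ y) (c ∷ d ∷ z) = trans
  (cong ((((a xor a') ∧ d) xor ((b xor b') ∧ c)) xor_) (Ω-⊕ˡ k x y z))
  (solve 8 (λ a a' b b' c d p q →
     (((a :+ a') :* d) :+ ((b :+ b') :* c)) :+ (p :+ q) :=
     ((a :* d) :+ (b :* c) :+ p) :+ ((a' :* d) :+ (b' :* c) :+ q))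
     refl a a' b b' c d (Ω k x z) (Ω k y z))

Ω-sym : ∀ k x y → Ω k x y ≡ Ω k y x
Ω-sym zero    []          []          = refl
Ω-sym (suc k) (a ∷ b ∷ x) (c ∷ d ∷ y) = cong₂ _xor_
  (solve 4 (λ a b c d → (a :* d) :+ (b :* c) := (c :* b) :+ (d :* a)) refl a b c d)
  (Ω-sym k x y)

Ω-alt : ∀ k x → Ω k x x ≡ false
Ω-alt zero    []          = refl
Ω-alt (suc k) (a ∷ b ∷ x) rewrite Ω-alt k x | 𝔹.∧-comm b a | 𝔹.xor-same (a ∧ b) = refl

-- The vector representing ℓ through Ω. The values at e and f are swapped because Ω pairs the
-- e-coordinate of one argument with the f-coordinate of the other.
riesz : ∀ k → (Vec Bool (k * 2) → Bool) → Vec Bool (k * 2)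
riesz zero    ℓ = []
riesz (suc k) ℓ = ℓ (false ∷ true ∷ 𝟎) ∷ ℓ (true ∷ false ∷ 𝟎) ∷ riesz k (λ x → ℓ (false ∷ false ∷ x))

Ω-riesz : ∀ k ℓ → Functional ℓ → ∀ x → Ω k (riesz k ℓ) x ≡ ℓ x
Ω-riesz zero    ℓ add []          = sym (functional-𝟎 ℓ add)
Ω-riesz (suc k) ℓ add (c ∷ d ∷ x) = begin
  ((f₁ ∧ d) xor (e₁ ∧ c)) xor Ω k (riesz k _) x
    ≡⟨ cong₂ _xor_ (trans (𝔹.xor-comm (f₁ ∧ d) (e₁ ∧ c)) (cong₂ _xor_ (𝔹.∧-comm e₁ c) (𝔹.∧-comm f₁ d)))
                   (Ω-riesz k _ (λ y z → add (false ∷ false ∷ y) (false ∷ false ∷ z)) x) ⟩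
  ((c ∧ e₁) xor (d ∧ f₁)) xor ℓ (false ∷ false ∷ x)
    ≡⟨ cong (_xor ℓ (false ∷ false ∷ x)) (cong₂ _xor_ (functional-· ℓ add c _) (functional-· ℓ add d _)) ⟨
  (ℓ (c · (true ∷ false ∷ 𝟎)) xor ℓ (d · (false ∷ true ∷ 𝟎))) xor ℓ (false ∷ false ∷ x)
    ≡⟨ cong (_xor ℓ (false ∷ false ∷ x)) (add _ _) ⟨
  ℓ (c · (true ∷ false ∷ 𝟎) ⊕ d · (false ∷ true ∷ 𝟎)) xor ℓ (false ∷ false ∷ x)
    ≡⟨ add _ _ ⟨
  ℓ (c · (true ∷ false ∷ 𝟎) ⊕ d · (false ∷ true ∷ 𝟎) ⊕ (false ∷ false ∷ x))
    ≡⟨ cong ℓ (split c d) ⟨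
  ℓ (c ∷ d ∷ x) ∎
  where
  open ≡-Reasoning
  e₁ = ℓ (true ∷ false ∷ 𝟎)
  f₁ = ℓ (false ∷ true ∷ 𝟎)
  x≡ : x ≡ 𝟎 ⊕ 𝟎 ⊕ x
  x≡ = sym (trans (cong (_⊕ x) (⊕-identityˡ 𝟎)) (⊕-identityˡ x))
  split : ∀ c d → c ∷ d ∷ x ≡ c · (true ∷ false ∷ 𝟎) ⊕ d · (false ∷ true ∷ 𝟎) ⊕ (false ∷ false ∷ x)
  split true  true  = cong (λ z → true ∷ true ∷ z) x≡
  split true  false = cong (λ z → true ∷ false ∷ z) x≡
  split false true  = cong (λ z → false ∷ true ∷ z) x≡
  split false false = cong (λ z → false ∷ false ∷ z) x≡

Ω-dual : ∀ k x → ¬ x ≡ 𝟎 → ∃ λ y → Ω k x y ≡ true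
Ω-dual zero    []                  x≢𝟎 = contradiction refl x≢𝟎
Ω-dual (suc k) (true ∷ b ∷ x)      x≢𝟎 = false ∷ true ∷ 𝟎 , eq
  where
  eq : (true xor (b ∧ false)) xor Ω k x 𝟎 ≡ true
  eq rewrite 𝔹.∧-zeroʳ b | Ω-sym k x 𝟎 = cong not (functional-𝟎 (λ y → Ω k y x) (λ y z → Ω-⊕ˡ k y z x))
Ω-dual (suc k) (false ∷ true ∷ x)  x≢𝟎 = true ∷ false ∷ 𝟎 , cong not
  (trans (Ω-sym k x 𝟎) (functional-𝟎 (λ y → Ω k y x) (λ y z → Ω-⊕ˡ k y z x)))
Ω-dual (suc k) (false ∷ false ∷ x) x≢𝟎 =
  let y , eq = Ω-dual k x (x≢𝟎 ∘ cong (λ z → false ∷ false ∷ z)) in false ∷ false ∷ y , eq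

standard : ∀ k → Symplectic (k * 2)
standard k = record { B = Ω k ; B-⊕ˡ = Ω-⊕ˡ k ; B-sym = Ω-sym k ; B-alt = Ω-alt k ; B-dual = Ω-dual k }

-- Isometries.

record Isometry {n} (S T : Symplectic n) : Set where
  field
    to       : Vec Bool n → Vec Bool n
    from     : Vec Bool n → Vec Bool n
    to-from  : ∀ x → to (from x) ≡ x
    from-to  : ∀ x → from (to x) ≡ x
    to-B     : ∀ x y → B T (to x) (to y) ≡ B S x y

  from-B : ∀ x y → B S (from x) (from y) ≡ B T x y
  from-B x y = trans (sym (to-B (from x) (from y))) (cong₂ (B T) (to-from x) (to-from y))

  to-B-from : ∀ x y → B T (to x) y ≡ B S x (from y)
  to-B-from x y = trans (cong (B T (to x)) (sym (to-from y))) (to-B x (from y))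

  -- `to x` is determined by its pairings with all z, and these equal the pairings of x with
  -- `from z`, which are additive in x. Linearity is thus derived rather than recorded as a field.
  to-additive : Additive to
  to-additive x y = Symplectic.B-separates T λ z → begin
    B T (to (x ⊕ y)) z              ≡⟨ to-B-from (x ⊕ y) z ⟩
    B S (x ⊕ y) (from z)            ≡⟨ Symplectic.B-⊕ˡ S x y (from z) ⟩
    B S x (from z) xor B S y (from z) ≡⟨ cong₂ _xor_ (to-B-from x z) (to-B-from y z) ⟨
    B T (to x) z xor B T (to y) z   ≡⟨ Symplectic.B-⊕ˡ T (to x) (to y) z ⟨
    B T (to x ⊕ to y) z             ∎
    where open ≡-Reasoning

  to-injective : ∀ {x y} → to x ≡ to y → x ≡ y
  to-injective {x} {y} eq = trans (sym (from-to x)) (trans (cong from eq) (from-to y))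

  to-≢𝟎 : ∀ {x} → ¬ x ≡ 𝟎 → ¬ to x ≡ 𝟎
  to-≢𝟎 x≢𝟎 eq = x≢𝟎 (to-injective (trans eq (sym (additive-𝟎 to to-additive))))

open Isometry using (to; from; to-from; from-to; to-B)

_⁻¹ : ∀ {n} {S T : Symplectic n} → Isometry S T → Isometry T S
f ⁻¹ = record
  { to = from f ; from = to f ; to-from = from-to f ; from-to = to-from f ; to-B = Isometry.from-B f }

infixr 9 _∙_
_∙_ : ∀ {n} {S T U : Symplectic n} → Isometry T U → Isometry S T → Isometry S U
g ∙ f = record
  { to      = to g ∘ to f
  ; from    = from f ∘ from g
  ; to-from = λ x → trans (cong (to g) (to-from f (from g x))) (to-from g x)
  ; from-to = λ x → trans (cong (from f) (from-to g (to f x))) (from-to f x)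
  ; to-B    = λ x y → trans (to-B g (to f x) (to f y)) (to-B f x y)
  }

infix 4 _≗ᵢ_
_≗ᵢ_ : ∀ {n} {S T : Symplectic n} → Isometry S T → Isometry S T → Set
f ≗ᵢ g = ∀ x → to f x ≡ to g x

from-cong : ∀ {n} {S T : Symplectic n} (f g : Isometry S T) → f ≗ᵢ g → ∀ x → from f x ≡ from g x
from-cong f g eq x = Isometry.to-injective f (trans (to-from f x) (sym (trans (eq (from g x)) (to-from g x))))

-- Classification of symplectic forms: an isometric embedding of a standard
-- space which is not yet onto misses a vector orthogonal to its image, and
-- this vector is completed to a further hyperbolic pair.

record Embedding (j : ℕ) {n} (S : Symplectic n) : Set where
  field
    embed    : Vec Bool (j * 2) → Vec Bool n
    additive : Additive embed
    embed-B  : ∀ x y → B S (embed x) (embed y) ≡ Ω j x y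

module _ {n} (S : Symplectic n) where
  open Symplectic S hiding (B)

  private
    BS = B S

  module _ {j} (φ : Embedding j S) (j<n : j * 2 < n) where
    open Embedding φ

    private
      functional : ∀ w → Functional (λ x → BS w (embed x))
      functional w x y = trans (cong (BS w) (additive x y)) (B-⊕ʳ w (embed x) (embed y))

      -- The adjoint of `embed`; `embed ∘ adj` is the orthogonal projection onto the image of
      -- `embed`.
      adj : Vec Bool n → Vec Bool (j * 2)
      adj w = riesz j (λ x → BS w (embed x))

      Ω-adj : ∀ w x → Ω j (adj w) x ≡ BS w (embed x)
      Ω-adj w = Ω-riesz j _ (functional w)

      adj-additive : Additive adj
      adj-additive v w = Symplectic.B-separates (standard j) λ x → begin
        Ω j (adj (v ⊕ w)) x                  ≡⟨ Ω-adj (v ⊕ w) x ⟩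
        BS (v ⊕ w) (embed x)                 ≡⟨ B-⊕ˡ v w (embed x) ⟩
        BS v (embed x) xor BS w (embed x)    ≡⟨ cong₂ _xor_ (Ω-adj v x) (Ω-adj w x) ⟨
        Ω j (adj v) x xor Ω j (adj w) x      ≡⟨ Ω-⊕ˡ j (adj v) (adj w) x ⟨
        Ω j (adj v ⊕ adj w) x                ∎
        where open ≡-Reasoning

    -- The orthogonal complement of the image is the kernel of the adjoint, which is nontrivial
    -- because the adjoint lowers the dimension.
    orthogonal : ∃ λ w → ¬ w ≡ 𝟎 × (∀ x → BS w (embed x) ≡ false)
    orthogonal =
      let w , w≢𝟎 , eq = kernel j<n adj adj-additive
      in w , w≢𝟎 , λ x → trans (sym (Ω-adj w x)) (trans (cong (λ v → Ω j v x) eq) (Symplectic.B-𝟎ˡ (standard j) x))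

    extend : Embedding (suc j) S
    extend with orthogonal
    ... | w , w≢𝟎 , w⊥ with B-dual w w≢𝟎
    ... | u₀ , Bwu₀ = record { embed = embed′ ; additive = additive′ ; embed-B = embed-B′ }
      where
      open ≡-Reasoning
      -- Removing the projection of `u₀` makes u orthogonal to the image; the pairing with w stays
      -- one because w is itself orthogonal to the image.
      u : Vec Bool n
      u = u₀ ⊕ embed (adj u₀)

      u⊥ : ∀ x → BS u (embed x) ≡ false
      u⊥ x = begin
        BS u (embed x)                                   ≡⟨ B-⊕ˡ u₀ (embed (adj u₀)) (embed x) ⟩
        BS u₀ (embed x) xor BS (embed (adj u₀)) (embed x) ≡⟨ cong (BS u₀ (embed x) xor_) (trans (embed-B (adj u₀) x) (Ω-adj u₀ x)) ⟩
        BS u₀ (embed x) xor BS u₀ (embed x)              ≡⟨ 𝔹.xor-same (BS u₀ (embed x)) ⟩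
        false                                            ∎

      Bwu : BS w u ≡ true
      Bwu = trans (B-⊕ʳ w u₀ _) (cong₂ _xor_ Bwu₀ (w⊥ (adj u₀)))

      embed′ : Vec Bool (suc j * 2) → Vec Bool n
      embed′ (a ∷ b ∷ x) = (a · w ⊕ b · u) ⊕ embed x

      additive′ : Additive embed′
      additive′ (a ∷ b ∷ x) (c ∷ d ∷ y) = begin
        ((a xor c) · w ⊕ (b xor d) · u) ⊕ embed (x ⊕ y)
          ≡⟨ cong₂ _⊕_ (cong₂ _⊕_ (·-xor a c w) (·-xor b d u)) (additive x y) ⟩
        ((a · w ⊕ c · w) ⊕ (b · u ⊕ d · u)) ⊕ (embed x ⊕ embed y)
          ≡⟨ cong (_⊕ (embed x ⊕ embed y)) (⊕-medial (a · w) (c · w) (b · u) (d · u)) ⟩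
        ((a · w ⊕ b · u) ⊕ (c · w ⊕ d · u)) ⊕ (embed x ⊕ embed y)
          ≡⟨ ⊕-medial (a · w ⊕ b · u) (c · w ⊕ d · u) (embed x) (embed y) ⟩
        embed′ (a ∷ b ∷ x) ⊕ embed′ (c ∷ d ∷ y) ∎

      B-embed′ : ∀ v c d y → BS v (embed′ (c ∷ d ∷ y)) ≡ ((c ∧ BS v w) xor (d ∧ BS v u)) xor BS v (embed y)
      B-embed′ v c d y = trans (B-⊕ʳ v _ (embed y)) (cong (_xor BS v (embed y))
        (trans (B-⊕ʳ v (c · w) (d · u)) (cong₂ _xor_ (B-·ʳ v c w) (B-·ʳ v d u))))

      embed-B′ : ∀ x y → BS (embed′ x) (embed′ y) ≡ Ω (suc j) x y
      embed-B′ (a ∷ b ∷ x) z@(c ∷ d ∷ y) = begin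
        BS (embed′ (a ∷ b ∷ x)) (embed′ z)
          ≡⟨ trans (B-sym _ _) (B-embed′ (embed′ z) a b x) ⟩
        ((a ∧ BS (embed′ z) w) xor (b ∧ BS (embed′ z) u)) xor BS (embed′ z) (embed x)
          ≡⟨ cong₂ _xor_ (cong₂ _xor_ (cong (a ∧_) w-coefficient) (cong (b ∧_) u-coefficient)) rest ⟩
        Ω (suc j) (a ∷ b ∷ x) z ∎
        where
        w-coefficient : BS (embed′ z) w ≡ d
        w-coefficient = trans (B-sym _ w) (trans (B-embed′ w c d y)
          (trans (cong₂ _xor_ (cong₂ _xor_ (cong (c ∧_) (B-alt w)) (cong (d ∧_) Bwu)) (w⊥ y))
            (solve 2 (λ c d → (c :* con false :+ d :* con true) :+ con false := d) refl c d)))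
        u-coefficient : BS (embed′ z) u ≡ c
        u-coefficient = trans (B-sym _ u) (trans (B-embed′ u c d y)
          (trans (cong₂ _xor_ (cong₂ _xor_ (cong (c ∧_) (trans (B-sym u w) Bwu)) (cong (d ∧_) (B-alt u))) (u⊥ y))
            (solve 2 (λ c d → (c :* con true :+ d :* con false) :+ con false := c) refl c d)))
        rest : BS (embed′ z) (embed x) ≡ Ω j x y
        rest = trans (B-sym _ (embed x)) (trans (B-embed′ (embed x) c d y)
          (trans (cong₂ _xor_ (cong₂ _xor_ (cong (c ∧_) (trans (B-sym (embed x) w) (w⊥ x)))
                                          (cong (d ∧_) (trans (B-sym (embed x) u) (u⊥ x))))
                              (embed-B x y))
            (solve 3 (λ c d p → (c :* con false :+ d :* con false) :+ p := p) refl c d (Ω j x y))))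

  embedding : ∀ j → j * 2 ≤ n → Embedding j S
  embedding zero    _   = record
    { embed    = λ _ → 𝟎
    ; additive = λ _ _ → sym (⊕-identityˡ 𝟎)
    ; embed-B  = λ { [] [] → B-𝟎ˡ 𝟎 }
    }
  embedding (suc j) j≤n = extend (embedding j (ℕ.≤-trans (ℕ.n≤1+n _) j<n)) j<n
    where
    j<n : j * 2 < n
    j<n = ℕ.≤-trans (ℕ.n≤1+n _) j≤n

-- An isometric embedding is injective by nondegeneracy of its source, and between finite sets of
-- equal size it is then onto.
classification : ∀ k (S : Symplectic (k * 2)) → Isometry (standard k) S
classification k S = record
  { to      = embed
  ; from    = λ y → proj₁ (onto y)
  ; to-from = λ y → proj₂ (onto y)
  ; from-to = λ x → injective (proj₂ (onto (embed x)))
  ; to-B    = embed-B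
  }
  where
  open Embedding (embedding S k ℕ.≤-refl)
  injective : ∀ {x y} → embed x ≡ embed y → x ≡ y
  injective {x} {y} eq = Symplectic.B-separates (standard k) λ z →
    trans (sym (embed-B x z)) (trans (cong (λ v → B S v (embed z)) eq) (embed-B y z))
  onto : ∀ y → ∃ λ x → embed x ≡ y
  onto = vec-surjective embed injective

-- Transvections and transitivity on nonzero vectors.

identity : ∀ {n} {S : Symplectic n} → Isometry S S
identity = record
  { to = id ; from = id ; to-from = λ _ → refl ; from-to = λ _ → refl ; to-B = λ _ _ → refl }

module _ {n} (S : Symplectic n) where
  open Symplectic S hiding (B)

  private
    BS = B S

  -- Adding a multiple of u leaves the pairing with u unchanged, so a second application adds the
  -- same multiple again and cancels it: the map is its own inverse.
  transvection : Vec Bool n → Isometry S S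
  transvection u = record
    { to = T ; from = T ; to-from = involutive ; from-to = involutive ; to-B = preserves }
    where
    T : Vec Bool n → Vec Bool n
    T x = x ⊕ BS x u · u
    BTu : ∀ x → BS (T x) u ≡ BS x u
    BTu x = trans (B-⊕ˡ x (BS x u · u) u) (trans (cong (BS x u xor_) (trans (B-·ˡ (BS x u) u u)
      (trans (cong (BS x u ∧_) (B-alt u)) (𝔹.∧-zeroʳ (BS x u))))) (𝔹.xor-identityʳ (BS x u)))
    involutive : ∀ x → T (T x) ≡ x
    involutive x = trans (cong (λ c → T x ⊕ c · u) (BTu x)) (⊕-cancelʳ x (BS x u · u))
    preserves : ∀ x y → BS (T x) (T y) ≡ BS x y
    preserves x y = begin
      BS (T x) (y ⊕ BS y u · u)
        ≡⟨ B-⊕ʳ (T x) y (BS y u · u) ⟩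
      BS (T x) y xor BS (T x) (BS y u · u)
        ≡⟨ cong₂ _xor_ (trans (B-⊕ˡ x _ y) (cong (BS x y xor_) (B-·ˡ (BS x u) u y)))
                       (trans (B-·ʳ (T x) (BS y u) u) (cong (BS y u ∧_) (BTu x))) ⟩
      (BS x y xor (BS x u ∧ BS u y)) xor (BS y u ∧ BS x u)
        ≡⟨ cong (λ c → (BS x y xor (BS x u ∧ c)) xor (BS y u ∧ BS x u)) (B-sym u y) ⟩
      (BS x y xor (BS x u ∧ BS y u)) xor (BS y u ∧ BS x u)
        ≡⟨ solve 3 (λ p q r → (p :+ q :* r) :+ r :* q := p) refl (BS x y) (BS x u) (BS y u) ⟩
      BS x y ∎
      where open ≡-Reasoning

  -- B(x, x + y) = B(x, y) = 1, so the transvection adds x + y to x.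
  transvection-moves : ∀ {x y} → BS x y ≡ true → to (transvection (x ⊕ y)) x ≡ y
  transvection-moves {x} {y} Bxy = trans
    (cong (λ c → x ⊕ c · (x ⊕ y)) (trans (B-⊕ʳ x x y) (cong₂ _xor_ (B-alt x) Bxy)))
    (⊕-cancelˡ x y)

  -- A partner u of x or a partner v of y serves directly, unless u is orthogonal to y and v to x;
  -- in that case u + v pairs to one with both.
  common-dual : ∀ {x y} → ¬ x ≡ 𝟎 → ¬ y ≡ 𝟎 → ∃ λ z → BS x z ≡ true × BS z y ≡ true
  common-dual {x} {y} x≢𝟎 y≢𝟎 with B-dual x x≢𝟎 | B-dual y y≢𝟎
  ... | u , Bxu | v , Byv with BS y u in Byu | BS x v in Bxv
  ... | true  | _     = u , Bxu , trans (B-sym u y) Byu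
  ... | false | true  = v , Bxv , trans (B-sym v y) Byv
  ... | false | false = u ⊕ v
    , trans (B-⊕ʳ x u v) (cong₂ _xor_ Bxu Bxv)
    , trans (B-sym _ y) (trans (B-⊕ʳ y u v) (cong₂ _xor_ Byu Byv))

  -- A transvection carries x to a different y only when the two pair to one; passing through a
  -- common partner removes this condition.
  transitive : ∀ {x y} → ¬ x ≡ 𝟎 → ¬ y ≡ 𝟎 → Σ (Isometry S S) λ f → to f x ≡ y
  transitive x≢𝟎 y≢𝟎 =
    let z , Bxz , Bzy = common-dual x≢𝟎 y≢𝟎
    in transvection _ ∙ transvection _
     , trans (cong (to (transvection _)) (transvection-moves Bxz)) (transvection-moves Bzy)

-- Coset representatives and the stabiliser of a hyperbolic pair.

module _ (k : ℕ) where
  e₁ f₁ : Vec Bool (suc k * 2)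
  e₁ = true ∷ false ∷ 𝟎
  f₁ = false ∷ true ∷ 𝟎

  open Symplectic (standard k) hiding (B)

  private
    Aut-Ω : ℕ → Set
    Aut-Ω k = Isometry (standard k) (standard k)

  Ω-e₁ : ∀ a b x → Ω (suc k) e₁ (a ∷ b ∷ x) ≡ b
  Ω-e₁ a b x = trans (cong ((b xor false) xor_) (B-𝟎ˡ x)) (trans (𝔹.xor-identityʳ _) (𝔹.xor-identityʳ b))

  Ω-f₁ : ∀ a b x → Ω (suc k) f₁ (a ∷ b ∷ x) ≡ a
  Ω-f₁ a b x = trans (cong (a xor_) (B-𝟎ˡ x)) (𝔹.xor-identityʳ a)

  -- The value for e = 𝟎 is junk.
  move : Vec Bool (suc k * 2) → Aut-Ω (suc k)
  move e with e ≟ᵥ 𝟎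
  ... | yes _   = identity
  ... | no e≢𝟎 = proj₁ (transitive (standard (suc k)) {e₁} (λ ()) e≢𝟎)

  move-e₁ : ∀ {e} → ¬ e ≡ 𝟎 → to (move e) e₁ ≡ e
  move-e₁ {e} e≢𝟎 with e ≟ᵥ 𝟎
  ... | yes e≡𝟎 = contradiction e≡𝟎 e≢𝟎
  ... | no e≢𝟎  = proj₂ (transitive (standard (suc k)) {e₁} (λ ()) e≢𝟎)

  -- The isometry fixing e₁, acting trivially on e₁^⊥ / e₁ and carrying f₁ to a e₁ + f₁ + y.
  shear : Vec Bool (suc (k * 2)) → Aut-Ω (suc k)
  shear (a ∷ y) = record
    { to = s ; from = s ; to-from = involutive ; from-to = involutive ; to-B = preserves }
    where
    s : Vec Bool (suc k * 2) → Vec Bool (suc k * 2)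
    s (p ∷ q ∷ x) = ((p xor (q ∧ a)) xor Ω k x y) ∷ q ∷ x ⊕ q · y
    Ω-⊕· : ∀ x q z → Ω k (x ⊕ q · y) z ≡ Ω k x z xor (q ∧ Ω k y z)
    Ω-⊕· x q z = trans (B-⊕ˡ x (q · y) z) (cong (Ω k x z xor_) (B-·ˡ q y z))
    involutive : ∀ x → s (s x) ≡ x
    involutive (p ∷ q ∷ x) = cong₂ (λ c z → c ∷ q ∷ z) scalar (⊕-cancelʳ x (q · y))
      where
      scalar : (((p xor (q ∧ a)) xor Ω k x y) xor (q ∧ a)) xor Ω k (x ⊕ q · y) y ≡ p
      scalar rewrite Ω-⊕· x q y | B-alt y =
        solve 4 (λ p q a w → (((p :+ q :* a) :+ w) :+ q :* a) :+ (w :+ q :* con false) := p) refl p q a (Ω k x y)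
    preserves : ∀ x z → Ω (suc k) (s x) (s z) ≡ Ω (suc k) x z
    preserves (p ∷ q ∷ x) (p' ∷ q' ∷ z)
      rewrite Ω-⊕· x q (z ⊕ q' · y) | B-sym x (z ⊕ q' · y) | B-sym y (z ⊕ q' · y)
            | Ω-⊕· z q' x | Ω-⊕· z q' y | B-alt y | B-sym y x | B-sym z x =
      solve 8 (λ p q p' q' a w w' v →
        ((((p :+ q :* a) :+ w) :* q') :+ (q :* ((p' :+ q' :* a) :+ w')))
          :+ ((v :+ q' :* w) :+ q :* (w' :+ q' :* con false)) :=
        (p :* q' :+ q :* p') :+ v)
        refl p q p' q' a (Ω k x y) (Ω k z y) (Ω k x z)

  shear-e₁ : ∀ u → to (shear u) e₁ ≡ e₁
  shear-e₁ (a ∷ y) = cong₂ (λ c z → c ∷ false ∷ z) (cong not (B-𝟎ˡ y)) (⊕-identityˡ 𝟎)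

  shear-f₁ : ∀ a y → to (shear (a ∷ y)) f₁ ≡ a ∷ true ∷ y
  shear-f₁ a y = cong₂ (λ c z → c ∷ true ∷ z) (trans (cong (a xor_) (B-𝟎ˡ y)) (𝔹.xor-identityʳ a)) (⊕-identityˡ y)

  lift : Aut-Ω k → Aut-Ω (suc k)
  lift g = record
    { to      = λ { (a ∷ b ∷ x) → a ∷ b ∷ to g x }
    ; from    = λ { (a ∷ b ∷ x) → a ∷ b ∷ from g x }
    ; to-from = λ { (a ∷ b ∷ x) → cong (λ z → a ∷ b ∷ z) (to-from g x) }
    ; from-to = λ { (a ∷ b ∷ x) → cong (λ z → a ∷ b ∷ z) (from-to g x) }
    ; to-B    = λ { (a ∷ b ∷ x) (c ∷ d ∷ y) → cong (((a ∧ d) xor (b ∧ c)) xor_) (to-B g x y) }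
    }

  drop₂ : Vec Bool (suc k * 2) → Vec Bool (k * 2)
  drop₂ (_ ∷ _ ∷ x) = x

  Fixes : Aut-Ω (suc k) → Set
  Fixes g = to g e₁ ≡ e₁ × to g f₁ ≡ f₁

  fixes-⁻¹ : ∀ g → Fixes g → Fixes (g ⁻¹)
  fixes-⁻¹ g (ge , gf) = trans (cong (from g) (sym ge)) (from-to g e₁) , trans (cong (from g) (sym gf)) (from-to g f₁)

  -- The coordinates along e₁ and f₁ are the pairings with f₁ and e₁. An isometry fixing both
  -- vectors preserves these pairings, hence the orthogonal complement of the pair.
  fixes-tail : ∀ g → Fixes g → ∀ x → to g (false ∷ false ∷ x) ≡ false ∷ false ∷ drop₂ (to g (false ∷ false ∷ x))
  fixes-tail g (ge , gf) x with to g (false ∷ false ∷ x) in eq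
  ... | a ∷ b ∷ z = cong₂ (λ a b → a ∷ b ∷ z) a≡ b≡
    where
    open ≡-Reasoning
    a≡ : a ≡ false
    a≡ = begin
      a                                             ≡⟨ Ω-f₁ a b z ⟨
      Ω (suc k) f₁ (a ∷ b ∷ z)                      ≡⟨ cong₂ (Ω (suc k)) gf eq ⟨
      Ω (suc k) (to g f₁) (to g (false ∷ false ∷ x)) ≡⟨ to-B g f₁ _ ⟩
      Ω (suc k) f₁ (false ∷ false ∷ x)              ≡⟨ Ω-f₁ false false x ⟩
      false                                         ∎
    b≡ : b ≡ false
    b≡ = begin
      b                                             ≡⟨ Ω-e₁ a b z ⟨
      Ω (suc k) e₁ (a ∷ b ∷ z)                      ≡⟨ cong₂ (Ω (suc k)) ge eq ⟨
      Ω (suc k) (to g e₁) (to g (false ∷ false ∷ x)) ≡⟨ to-B g e₁ _ ⟩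
      Ω (suc k) e₁ (false ∷ false ∷ x)              ≡⟨ Ω-e₁ false false x ⟩
      false                                         ∎

  restrict : ∀ g → Fixes g → Aut-Ω k
  restrict g fix = record
    { to      = λ x → drop₂ (to g (false ∷ false ∷ x))
    ; from    = λ x → drop₂ (from g (false ∷ false ∷ x))
    ; to-from = λ x → cong drop₂ (trans (cong (to g) (sym (fixes-tail (g ⁻¹) (fixes-⁻¹ g fix) x))) (to-from g _))
    ; from-to = λ x → cong drop₂ (trans (cong (from g) (sym (fixes-tail g fix x))) (from-to g _))
    ; to-B    = λ x y → trans (sym (cong₂ (Ω (suc k)) (fixes-tail g fix x) (fixes-tail g fix y)))
                              (to-B g (false ∷ false ∷ x) (false ∷ false ∷ y))
    }

  -- By linearity g is known from its values on e₁, on f₁ and on the complement of the pair.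
  lift-restrict : ∀ g fix → lift (restrict g fix) ≗ᵢ g
  lift-restrict g fix@(ge , gf) (a ∷ b ∷ x) = begin
    a ∷ b ∷ drop₂ (to g (false ∷ false ∷ x))
      ≡⟨ split a b (drop₂ (to g (false ∷ false ∷ x))) ⟩
    a · e₁ ⊕ b · f₁ ⊕ (false ∷ false ∷ drop₂ (to g (false ∷ false ∷ x)))
      ≡⟨ cong₂ _⊕_ (cong₂ _⊕_ (cong (a ·_) ge) (cong (b ·_) gf)) (fixes-tail g fix x) ⟨
    a · to g e₁ ⊕ b · to g f₁ ⊕ to g (false ∷ false ∷ x)
      ≡⟨ cong (_⊕ to g (false ∷ false ∷ x)) (cong₂ _⊕_ (additive-· (to g) add a e₁) (additive-· (to g) add b f₁)) ⟨
    to g (a · e₁) ⊕ to g (b · f₁) ⊕ to g (false ∷ false ∷ x)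
      ≡⟨ trans (add _ _) (cong (_⊕ to g (false ∷ false ∷ x)) (add _ _)) ⟨
    to g (a · e₁ ⊕ b · f₁ ⊕ (false ∷ false ∷ x))
      ≡⟨ cong (to g) (split a b x) ⟨
    to g (a ∷ b ∷ x) ∎
    where
    open ≡-Reasoning
    add = Isometry.to-additive g
    split : ∀ a b x → a ∷ b ∷ x ≡ a · e₁ ⊕ b · f₁ ⊕ (false ∷ false ∷ x)
    split a b x = lemma a b
      where
      x≡ : x ≡ 𝟎 ⊕ 𝟎 ⊕ x
      x≡ = sym (trans (cong (_⊕ x) (⊕-identityˡ 𝟎)) (⊕-identityˡ x))
      lemma : ∀ a b → a ∷ b ∷ x ≡ a · e₁ ⊕ b · f₁ ⊕ (false ∷ false ∷ x)
      lemma true  true  = cong (λ z → true ∷ true ∷ z) x≡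
      lemma true  false = cong (λ z → true ∷ false ∷ z) x≡
      lemma false true  = cong (λ z → false ∷ true ∷ z) x≡
      lemma false false = cong (λ z → false ∷ false ∷ z) x≡

-- The order of the isometry group.

isometries : ∀ {n} → Symplectic n → Symplectic n → Setoid 0ℓ 0ℓ
isometries S T = record
  { Carrier = Isometry S T
  ; _≈_ = _≗ᵢ_
  ; isEquivalence = record
    { refl = λ _ → refl ; sym = λ eq x → sym (eq x) ; trans = λ eq₁ eq₂ x → trans (eq₁ x) (eq₂ x) }
  }

-- Equality ignores the proof of disequality, since two such proofs are functions and are not
-- provably equal without extensionality.
others : {A : Set} → A → Setoid 0ℓ 0ℓ
others {A} a = record
  { Carrier = Σ A λ x → ¬ x ≡ a
  ; _≈_ = λ x y → proj₁ x ≡ proj₁ y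
  ; isEquivalence = record { refl = refl ; sym = sym ; trans = trans }
  }

module _ (k : ℕ) where
  private
    Aut-Ω : ℕ → Set
    Aut-Ω k = Isometry (standard k) (standard k)

    e₁≢𝟎 : ¬ e₁ k ≡ 𝟎
    e₁≢𝟎 ()

    -- The f₁-coordinate is discarded: for the image of f₁ under an isometry fixing e₁, the pairing
    -- with e₁ forces it to be one.
    tailf : Vec Bool (suc k * 2) → Vec Bool (suc (k * 2))
    tailf (a ∷ _ ∷ y) = a ∷ y

    module Decompose (g : Aut-Ω (suc k)) where
      e : Vec Bool (suc k * 2)
      e = to g (e₁ k)
      e≢𝟎 : ¬ e ≡ 𝟎
      e≢𝟎 = Isometry.to-≢𝟎 g e₁≢𝟎
      g₁ : Aut-Ω (suc k)
      g₁ = move k e ⁻¹ ∙ g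
      g₁-e₁ : to g₁ (e₁ k) ≡ e₁ k
      g₁-e₁ = trans (cong (from (move k e)) (sym (move-e₁ k e≢𝟎))) (from-to (move k e) (e₁ k))
      u : Vec Bool (suc (k * 2))
      u = tailf (to g₁ (f₁ k))
      g₂ : Aut-Ω (suc k)
      g₂ = shear k u ⁻¹ ∙ g₁
      shear-u : to (shear k u) (f₁ k) ≡ to g₁ (f₁ k)
      shear-u with to g₁ (f₁ k) in eq
      ... | a ∷ b ∷ y = trans (shear-f₁ k a y) (cong (λ c → a ∷ c ∷ y) (sym b≡))
        where
        open ≡-Reasoning
        b≡ : b ≡ true
        b≡ = begin
          b                                          ≡⟨ Ω-e₁ k a b y ⟨
          Ω (suc k) (e₁ k) (a ∷ b ∷ y)               ≡⟨ cong₂ (Ω (suc k)) g₁-e₁ eq ⟨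
          Ω (suc k) (to g₁ (e₁ k)) (to g₁ (f₁ k))    ≡⟨ to-B g₁ (e₁ k) (f₁ k) ⟩
          Ω (suc k) (e₁ k) (f₁ k)                    ≡⟨ Ω-e₁ k false true 𝟎 ⟩
          true                                       ∎
      fixes : Fixes k g₂
      fixes = trans (cong (from (shear k u)) (trans g₁-e₁ (sym (shear-e₁ k u)))) (from-to (shear k u) (e₁ k))
            , trans (cong (from (shear k u)) (sym shear-u)) (from-to (shear k u) (f₁ k))

    assemble : Vec Bool (suc k * 2) → Vec Bool (suc (k * 2)) → Aut-Ω k → Aut-Ω (suc k)
    assemble e u g = move k e ∙ shear k u ∙ lift k g

  -- Orbit counting with explicit coset representatives: 2^(2k+2) - 1 nonzero images for e₁, then
  -- 2^(2k+1) images for f₁. The bijection is one of sets, not of groups.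
  decomposition : Inverse (isometries (standard (suc k)) (standard (suc k)))
    (×._×ₛ_ (isometries (standard k) (standard k)) (×._×ₛ_ (others {Vec Bool (suc k * 2)} 𝟎) (setoid (Vec Bool (suc (k * 2))))))
  decomposition = record
    { to        = λ g → let open Decompose g in restrict k g₂ fixes , (e , e≢𝟎) , u
    ; from      = λ { (g , (e , _) , u) → assemble e u g }
    ; to-cong   = λ {g} {g'} eq → let e≡ , u≡ , r≡ = invariants g g' eq in r≡ , e≡ , u≡
    ; from-cong = λ { {_ , (e , _) , u} {_ , _} (g≡ , refl , refl) (a ∷ b ∷ x) →
                      cong (λ z → to (move k e) (to (shear k u) (a ∷ b ∷ z))) (g≡ x) }
    ; inverse   = (λ { {g , (e , e≢𝟎) , u} {h} eq →
                       let e≡ , u≡ , r≡ = invariants h (assemble e u g) eq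
                           e≡' , u≡' , r≡' = invariants-assemble e e≢𝟎 u g
                       in (λ x → trans (r≡ x) (r≡' x)) , trans e≡ e≡' , trans u≡ u≡' })
                , (λ { {g} {g' , (e , _) , u} (g≡ , refl , refl) x → let open Decompose g using (g₁; g₂; fixes) in
                       trans (cong (to (move k e) ∘ to (shear k u)) (trans (lift-cong g' (restrict k g₂ fixes) g≡ x) (lift-restrict k g₂ fixes x)))
                             (trans (cong (to (move k e)) (to-from (shear k u) (to g₁ x))) (to-from (move k e) (to g x))) })
    }
    where
    lift-cong : ∀ g g' → g ≗ᵢ g' → lift k g ≗ᵢ lift k g'
    lift-cong g g' eq (a ∷ b ∷ x) = cong (λ z → a ∷ b ∷ z) (eq x)
    invariants : ∀ g g' → g ≗ᵢ g' →
      Decompose.e g ≡ Decompose.e g' × Decompose.u g ≡ Decompose.u g' ×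
      (restrict k (Decompose.g₂ g) (Decompose.fixes g) ≗ᵢ restrict k (Decompose.g₂ g') (Decompose.fixes g'))
    -- `move` and `shear` take bare vectors without proofs, so equal invariants can be substituted
    -- into them directly.
    invariants g g' eq = e≡ , u≡ , λ x → cong (drop₂ k)
        (cong₂ (λ v z → from (shear k v) z) u≡ (cong₂ (λ e z → from (move k e) z) e≡ (eq _)))
      where
      e≡ = eq (e₁ k)
      u≡ = cong tailf (cong₂ (λ e z → from (move k e) z) e≡ (eq (f₁ k)))
    invariants-assemble : ∀ e (e≢𝟎 : ¬ e ≡ 𝟎) u g → let open Decompose (assemble e u g) using (g₂; fixes) renaming (e to e'; u to u') in
      e' ≡ e × u' ≡ u × (restrict k g₂ fixes ≗ᵢ g)
    invariants-assemble e e≢𝟎 u@(a ∷ y) g = e≡ , u≡ , λ x → cong (drop₂ k)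
        (trans (cong₂ (λ v z → from (shear k v) z) u≡ (g₁≡ (false ∷ false ∷ x))) (from-to (shear k u) (false ∷ false ∷ to g x)))
      where
      open Decompose (assemble e u g) using (g₁) renaming (e to e'; u to u')
      e≡ : e' ≡ e
      e≡ = trans
        (cong (to (move k e)) (trans
          (cong (to (shear k u)) (cong (λ z → true ∷ false ∷ z) (additive-𝟎 (to g) (Isometry.to-additive g))))
          (shear-e₁ k u)))
        (move-e₁ k e≢𝟎)
      g₁≡ : ∀ x → to g₁ x ≡ to (shear k u ∙ lift k g) x
      g₁≡ x = trans (cong (λ d → from (move k d) (to (assemble e u g) x)) e≡) (from-to (move k e) (to (shear k u ∙ lift k g) x))
      u≡ : u' ≡ u
      u≡ = cong tailf (trans (g₁≡ (f₁ k)) (trans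
        (cong (to (shear k u)) (cong (λ z → false ∷ true ∷ z) (additive-𝟎 (to g) (Isometry.to-additive g))))
        (shear-f₁ k a y)))

remove : ∀ {A : Set} {N} → A ↔ Fin N → (a : A) → Inverse (others a) (setoid (Fin (N ∸ 1)))
remove {N = zero} E a with Inverse.to E a
... | ()
remove {A} {suc N} E a = record
  { to        = λ { (x , x≢a) → Fin.punchOut (ne x≢a) }
  ; from      = λ i → dec (Fin.punchIn (enc a) i)
                    , λ eq → Fin.punchInᵢ≢i (enc a) i (trans (sym (strictlyInverseˡ _)) (cong enc eq))
  ; to-cong   = λ { eq → Fin.punchOut-cong (enc a) (cong enc eq) }
  ; from-cong = λ { refl → refl }
  ; inverse   = (λ {i} eq → trans (Fin.punchOut-cong (enc a) (trans (cong enc eq) (strictlyInverseˡ _))) (Fin.punchOut-punchIn (enc a)))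
              , λ { {x , x≢a} refl → trans (cong dec (Fin.punchIn-punchOut (ne x≢a))) (strictlyInverseʳ x) }
  }
  where
  open Inverse E using (strictlyInverseˡ; strictlyInverseʳ) renaming (to to enc; from to dec)
  ne : ∀ {x} → ¬ x ≡ a → ¬ enc a ≡ enc x
  ne x≢a eq = x≢a (trans (sym (strictlyInverseʳ _)) (trans (cong dec (sym eq)) (strictlyInverseʳ a)))

infixr 2 _×-fin_
_×-fin_ : ∀ {S T : Setoid 0ℓ 0ℓ} {M N} → Inverse S (setoid (Fin M)) → Inverse T (setoid (Fin N)) →
          Inverse (×._×ₛ_ S T) (setoid (Fin (M * N)))
E ×-fin F = Comp.inverse (E ×-inverse F) (Comp.inverse ×.Pointwise-≡↔≡ (Symm.inverse Fin.*↔×))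

card-isometries : ∀ k → Inverse (isometries (standard k) (standard k)) (setoid (Fin (spOrder k)))
card-isometries zero = record
  { to        = λ _ → Fin.zero
  ; from      = λ _ → identity
  ; to-cong   = λ _ → refl
  ; from-cong = λ _ _ → refl
  ; inverse   = (λ { {Fin.zero} _ → refl ; {Fin.suc ()} _ }) , λ {f} _ x → empty x (to f x)
  }
  where
  empty : (x y : Vec Bool 0) → x ≡ y
  empty [] [] = refl
card-isometries (suc k) = subst (λ N → Inverse (isometries (standard (suc k)) (standard (suc k))) (setoid (Fin (spOrder k * N)))) order
  (Comp.inverse (decomposition k) (card-isometries k ×-fin remove (vec↔fin (suc k * 2)) 𝟎 ×-fin vec↔fin (suc (k * 2))))
  where
  order : (2 ^ (suc k * 2) ∸ 1) * 2 ^ suc (k * 2) ≡ (2 ^ (2 * suc k) ∸ 1) * 2 ^ (2 * k + 1)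
  order = cong₂ (λ a b → (2 ^ a ∸ 1) * 2 ^ b) (ℕ.*-comm (suc k) 2) (trans (cong suc (ℕ.*-comm k 2)) (ℕ.+-comm 1 (2 * k)))

conjugation : ∀ {n} {S T : Symplectic n} → Isometry S T → Inverse (isometries S S) (isometries T T)
conjugation f = record
  { to        = λ g → f ∙ g ∙ f ⁻¹
  ; from      = λ g → f ⁻¹ ∙ g ∙ f
  ; to-cong   = λ eq x → cong (to f) (eq (from f x))
  ; from-cong = λ eq x → cong (from f) (eq (to f x))
  ; inverse   = (λ {g} {h} eq x → trans (cong (to f) (trans (eq (from f x)) (cong (from f ∘ to g) (to-from f x)))) (to-from f (to g x)))
              , (λ {g} {h} eq x → trans (cong (from f) (trans (eq (to f x)) (cong (to f ∘ to g) (from-to f x)))) (from-to f (to g x)))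
  }

-- Matrices, and Sp as the isometry group of the given form.

⨁-∧ʳ : ∀ {n} b (f : Fin n → Bool) → ⨁ (λ i → f i ∧ b) ≡ ⨁ f ∧ b
⨁-∧ʳ b f = trans (⨁-cong (λ i → 𝔹.∧-comm (f i) b)) (trans (⨁-∧ˡ b f) (𝔹.∧-comm b (⨁ f)))

apply-cong : ∀ {m} {A A' : Mat m} {x y : BVec m} → A ≈M A' → (∀ i → x i ≡ y i) → ∀ i → apply A x i ≡ apply A' y i
apply-cong A≈ x≈ i = ⨁-cong (λ j → cong₂ _∧_ (A≈ i j) (x≈ j))

apply-⊛ : ∀ {m} (A A' : Mat m) x i → apply (A ⊛ A') x i ≡ apply A (apply A' x) i
apply-⊛ A A' x i = begin
  ⨁ (λ j → ⨁ (λ k → A i k ∧ A' k j) ∧ x j)   ≡⟨ ⨁-cong (λ j → ⨁-∧ʳ (x j) (λ k → A i k ∧ A' k j)) ⟨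
  ⨁ (λ j → ⨁ (λ k → (A i k ∧ A' k j) ∧ x j)) ≡⟨ ⨁-comm (λ j k → (A i k ∧ A' k j) ∧ x j) ⟩
  ⨁ (λ k → ⨁ (λ j → (A i k ∧ A' k j) ∧ x j)) ≡⟨ ⨁-cong (λ k → ⨁-cong (λ j → 𝔹.∧-assoc (A i k) (A' k j) (x j))) ⟩
  ⨁ (λ k → ⨁ (λ j → A i k ∧ A' k j ∧ x j))   ≡⟨ ⨁-cong (λ k → ⨁-∧ˡ (A i k) (λ j → A' k j ∧ x j)) ⟩
  ⨁ (λ k → A i k ∧ ⨁ (λ j → A' k j ∧ x j))   ∎
  where open ≡-Reasoning

apply-basis : ∀ {m} (A : Mat m) j i → apply A (lookup (basis j)) i ≡ A i j
apply-basis A j i = trans (⨁-cong (λ k → cong (A i k ∧_) (lookup-basis k j))) (⨁-δ (A i) j)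

matrix : ∀ {m} → (Vec Bool m → Vec Bool m) → Mat m
matrix f i j = lookup (f (basis j)) i

apply-matrix : ∀ {m} (f : Vec Bool m → Vec Bool m) → Additive f → ∀ x i → apply (matrix f) (lookup x) i ≡ lookup (f x) i
apply-matrix f add x i = trans (⨁-cong (λ j → 𝔹.∧-comm (matrix f i j) (lookup x j)))
  (sym (functional-expand (λ y → lookup (f y) i) (functional-lookup f add i) x))

matrix-∘ : ∀ {m} (f g : Vec Bool m → Vec Bool m) → Additive f → matrix (f ∘ g) ≈M (matrix f ⊛ matrix g)
matrix-∘ f g add i j = sym (apply-matrix f add (g (basis j)) i)

apply-idMat : ∀ {m} (x : BVec m) i → apply idMat x i ≡ x i
apply-idMat x i = trans (⨁-cong (λ j → trans (𝔹.∧-comm (idMat i j) (x j)) (cong (x j ∧_) (idMat-sym i j)))) (⨁-δ x i)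
  where
  idMat-sym : ∀ {m} (i j : Fin m) → idMat i j ≡ idMat j i
  idMat-sym Fin.zero    Fin.zero    = refl
  idMat-sym Fin.zero    (Fin.suc j) = refl
  idMat-sym (Fin.suc i) Fin.zero    = refl
  idMat-sym (Fin.suc i) (Fin.suc j) = idMat-sym i j

bil-cong : ∀ {m} (G : Mat m) {x x' y y' : BVec m} → (∀ i → x i ≡ x' i) → (∀ i → y i ≡ y' i) → bil G x y ≡ bil G x' y'
bil-cong G x≈ y≈ = ⨁-cong λ i → ⨁-cong λ j → cong₂ (λ a b → a ∧ G i j ∧ b) (x≈ i) (y≈ j)

module _ {m} (G : Mat m) (alternating : Alternating G) (nondegenerate : Nondegenerate G) where
  private
    β : Vec Bool m → Vec Bool m → Bool
    β x y = bil G (lookup x) (lookup y)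

    β-⊕ˡ : ∀ x y z → β (x ⊕ y) z ≡ β x z xor β y z
    β-⊕ˡ x y z = functional-sum _ (λ i → functional-sum (λ j x → lookup x i ∧ G i j ∧ lookup z j) (λ j x y →
      trans (cong (_∧ (G i j ∧ lookup z j)) (lookup-⊕ x y i)) (𝔹.∧-distribʳ-xor (G i j ∧ lookup z j) (lookup x i) (lookup y i)))) x y

    β-⊕ʳ : ∀ x y z → β x (y ⊕ z) ≡ β x y xor β x z
    β-⊕ʳ x = functional-sum _ (λ i → functional-sum (λ j y → lookup x i ∧ G i j ∧ lookup y j) (λ j y z →
      trans (cong (λ c → lookup x i ∧ G i j ∧ c) (lookup-⊕ y z j))
        (solve 4 (λ a b c d → a :* (b :* (c :+ d)) := a :* (b :* c) :+ a :* (b :* d)) refl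
          (lookup x i) (G i j) (lookup y j) (lookup z j))))

    -- Polarisation: in the expansion of β(x + y, x + y) = 0 the terms β(x, x) and β(y, y) vanish,
    -- leaving β(x, y) + β(y, x) = 0.
    β-sym : ∀ x y → β x y ≡ β y x
    β-sym x y = xor-≡ (begin
      β x y xor β y x
        ≡⟨ cong (β x y xor_) (𝔹.xor-identityʳ (β y x)) ⟨
      β x y xor (β y x xor false)
        ≡⟨ cong₂ (λ a b → (a xor β x y) xor (β y x xor b)) (alternating (lookup x)) (alternating (lookup y)) ⟨
      (β x x xor β x y) xor (β y x xor β y y)
        ≡⟨ cong₂ _xor_ (β-⊕ʳ x x y) (β-⊕ʳ y x y) ⟨
      β x (x ⊕ y) xor β y (x ⊕ y)
        ≡⟨ β-⊕ˡ x y (x ⊕ y) ⟨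
      β (x ⊕ y) (x ⊕ y)
        ≡⟨ alternating (lookup (x ⊕ y)) ⟩
      false ∎)
      where open ≡-Reasoning

    β-dual : ∀ x → ¬ x ≡ 𝟎 → ∃ λ y → β x y ≡ true
    β-dual x x≢𝟎 with search (β x)
    ... | inj₁ found = found
    ... | inj₂ none  = contradiction
      (lookup-ext λ i → trans
        (nondegenerate (lookup x) (λ y → trans (bil-cong G {x = lookup x} (λ _ → refl) (sym ∘ Vec.lookup∘tabulate y)) (none (tabulate y))) i)
        (sym (lookup-𝟎 i)))
      x≢𝟎

  form : Symplectic m
  form = record
    { B = β ; B-⊕ˡ = β-⊕ˡ ; B-sym = β-sym ; B-alt = λ x → alternating (lookup x) ; B-dual = β-dual }

  private
    mul : Mat m → Vec Bool m → Vec Bool m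
    mul A x = tabulate (apply A (lookup x))

    mul-inverse : ∀ A A' → (A ⊛ A') ≈M idMat → ∀ x → mul A (mul A' x) ≡ x
    mul-inverse A A' inv x = lookup-ext λ i → begin
      lookup (mul A (mul A' x)) i                ≡⟨ Vec.lookup∘tabulate _ i ⟩
      apply A (lookup (mul A' x)) i              ≡⟨ apply-cong {A = A} (λ _ _ → refl) (Vec.lookup∘tabulate _) i ⟩
      apply A (apply A' (lookup x)) i            ≡⟨ apply-⊛ A A' (lookup x) i ⟨
      apply (A ⊛ A') (lookup x) i                ≡⟨ apply-cong {y = lookup x} inv (λ _ → refl) i ⟩
      apply idMat (lookup x) i                   ≡⟨ apply-idMat (lookup x) i ⟩
      lookup x i                                 ∎
      where open ≡-Reasoning

    matrix-inverse : (f g : Vec Bool m → Vec Bool m) → Additive f → (∀ x → f (g x) ≡ x) →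
                     (matrix f ⊛ matrix g) ≈M idMat
    matrix-inverse f g add inv i j = trans (sym (matrix-∘ f g add i j))
      (trans (cong (λ x → lookup x i) (inv (basis j))) (lookup-basis i j))

  Sp-setoid : Setoid 0ℓ 0ℓ
  Sp-setoid = record
    { Carrier = Sp G
    ; _≈_ = _≈Sp_
    ; isEquivalence = record
      { refl = λ _ _ → refl ; sym = λ eq i j → sym (eq i j) ; trans = λ p q i j → trans (p i j) (q i j) }
    }

  isometry→Sp : Isometry form form → Sp G
  isometry→Sp f = matrix (to f)
    , (matrix (from f) , matrix-inverse (to f) (from f) (Isometry.to-additive f) (to-from f)
                       , matrix-inverse (from f) (to f) (Isometry.to-additive (f ⁻¹)) (from-to f))
    , λ x y → begin
      bil G (apply (matrix (to f)) x) (apply (matrix (to f)) y)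
        ≡⟨ bil-cong G (apply-to x) (apply-to y) ⟩
      β (to f (tabulate x)) (to f (tabulate y))
        ≡⟨ to-B f (tabulate x) (tabulate y) ⟩
      β (tabulate x) (tabulate y)
        ≡⟨ bil-cong G (Vec.lookup∘tabulate x) (Vec.lookup∘tabulate y) ⟩
      bil G x y ∎
    where
    open ≡-Reasoning
    apply-to : ∀ x i → apply (matrix (to f)) x i ≡ lookup (to f (tabulate x)) i
    apply-to x i = trans (apply-cong {A = matrix (to f)} (λ _ _ → refl) (sym ∘ Vec.lookup∘tabulate x) i)
                         (apply-matrix (to f) (Isometry.to-additive f) (tabulate x) i)

  isometries↔Sp : Inverse (isometries form form) Sp-setoid
  isometries↔Sp = record
    { to        = isometry→Sp
    ; from      = λ { (A , (A' , AA' , A'A) , preserves) → record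
        { to      = mul A
        ; from    = mul A'
        ; to-from = mul-inverse A A' AA'
        ; from-to = mul-inverse A' A A'A
        ; to-B    = λ x y → trans (bil-cong G (Vec.lookup∘tabulate _) (Vec.lookup∘tabulate _)) (preserves (lookup x) (lookup y))
        } }
    ; to-cong   = λ eq i j → cong (λ x → lookup x i) (eq (basis j))
    ; from-cong = λ eq x → Vec.tabulate-cong (apply-cong {y = lookup x} eq (λ _ → refl))
    ; inverse   = (λ { {A , _} {f} eq i j → trans (cong (λ x → lookup x i) (eq (basis j)))
                       (trans (Vec.lookup∘tabulate _ i) (apply-basis A j i)) })
                , (λ { {f} {A , _} eq x → lookup-ext λ i → trans (Vec.lookup∘tabulate _ i)
                       (trans (apply-cong {y = lookup x} eq (λ _ → refl) i) (apply-matrix (to f) (Isometry.to-additive f) x i)) })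
    }

-- Binary digits of the Hamming weight: wt x ≡ parity x + 2 pairs x (mod 4),
-- as wt x choose 2 is the value of the second elementary symmetric polynomial.

parity : ∀ {n} → Vec Bool n → Bool
parity []      = false
parity (a ∷ x) = a xor parity x

pairs : ∀ {n} → Vec Bool n → Bool
pairs []      = false
pairs (a ∷ x) = (a ∧ parity x) xor pairs x

digits : Bool → Bool → ℕ
digits p s = (if p then 1 else 0) + (if s then 2 else 0)

weight%4 : ∀ {n} (x : Vec Bool n) → weight (lookup x) % 4 ≡ digits (parity x) (pairs x)
weight%4 []      = refl
weight%4 (a ∷ x) = begin
  ((if a then 1 else 0) + weight (lookup x)) % 4
    ≡⟨ %-distribˡ-+ (if a then 1 else 0) (weight (lookup x)) 4 ⟩
  ((if a then 1 else 0) % 4 + weight (lookup x) % 4) % 4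
    ≡⟨ cong (λ w → ((if a then 1 else 0) % 4 + w) % 4) (weight%4 x) ⟩
  ((if a then 1 else 0) % 4 + digits (parity x) (pairs x)) % 4
    ≡⟨ carry a (parity x) (pairs x) ⟩
  digits (a xor parity x) ((a ∧ parity x) xor pairs x) ∎
  where
  open ≡-Reasoning
  -- The low digit carries exactly when a and p are both one; a carry out of the second digit is
  -- lost modulo 4.
  carry : ∀ a p s → ((if a then 1 else 0) % 4 + digits p s) % 4 ≡ digits (a xor p) ((a ∧ p) xor s)
  carry true  true  true  = refl
  carry true  true  false = refl
  carry true  false true  = refl
  carry true  false false = refl
  carry false true  true  = refl
  carry false true  false = refl
  carry false false true  = refl
  carry false false false = refl

Γ : ∀ {n} → Vec Bool n → Vec Bool n → Bool
Γ []      []      = false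
Γ (a ∷ x) (c ∷ y) = ((a ∧ parity y) xor (c ∧ parity x)) xor Γ x y

parity-⊕ : ∀ {n} (x y : Vec Bool n) → parity (x ⊕ y) ≡ parity x xor parity y
parity-⊕ []      []      = refl
parity-⊕ (a ∷ x) (c ∷ y) = trans (cong ((a xor c) xor_) (parity-⊕ x y))
  (solve 4 (λ a c p q → (a :+ c) :+ (p :+ q) := (a :+ p) :+ (c :+ q)) refl a c (parity x) (parity y))

-- For i < j the product (x_i + y_i)(x_j + y_j) has the cross terms x_i y_j + x_j y_i, and over all
-- i < j these add up to Γ.
pairs-⊕ : ∀ {n} (x y : Vec Bool n) → pairs (x ⊕ y) ≡ (pairs x xor pairs y) xor Γ x y
pairs-⊕ []      []      = refl
pairs-⊕ (a ∷ x) (c ∷ y) = trans (cong₂ (λ p s → ((a xor c) ∧ p) xor s) (parity-⊕ x y) (pairs-⊕ x y))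
  (solve 7 (λ a c p q s t g →
     ((a :+ c) :* (p :+ q)) :+ ((s :+ t) :+ g) :=
     ((a :* p :+ s) :+ (c :* q :+ t)) :+ ((a :* q :+ c :* p) :+ g))
     refl a c (parity x) (parity y) (pairs x) (pairs y) (Γ x y))

Γ-⊕ˡ : ∀ {n} (x y z : Vec Bool n) → Γ (x ⊕ y) z ≡ Γ x z xor Γ y z
Γ-⊕ˡ []      []      []      = refl
Γ-⊕ˡ (a ∷ x) (b ∷ y) (c ∷ z) = trans
  (cong₂ (λ p g → (((a xor b) ∧ parity z) xor (c ∧ p)) xor g) (parity-⊕ x y) (Γ-⊕ˡ x y z))
  (solve 8 (λ a b c p q r g g' →
     (((a :+ b) :* r) :+ (c :* (p :+ q))) :+ (g :+ g') :=
     ((a :* r :+ c :* p) :+ g) :+ ((b :* r :+ c :* q) :+ g'))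
     refl a b c (parity x) (parity y) (parity z) (Γ x z) (Γ y z))

Γ-sym : ∀ {n} (x y : Vec Bool n) → Γ x y ≡ Γ y x
Γ-sym []      []      = refl
Γ-sym (a ∷ x) (c ∷ y) = cong₂ _xor_ (𝔹.xor-comm (a ∧ parity y) (c ∧ parity x)) (Γ-sym x y)

Γ-alt : ∀ {n} (x : Vec Bool n) → Γ x x ≡ false
Γ-alt []      = refl
Γ-alt (a ∷ x) = cong₂ _xor_ (𝔹.xor-same (a ∧ parity x)) (Γ-alt x)

Γ-𝟎ʳ : ∀ {n} (x : Vec Bool n) → Γ x 𝟎 ≡ false
Γ-𝟎ʳ x = trans (Γ-sym x 𝟎) (functional-𝟎 (λ y → Γ y x) (λ y z → Γ-⊕ˡ y z x))

parity-𝟎 : ∀ n → parity {n} 𝟎 ≡ false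
parity-𝟎 n = functional-𝟎 {n} parity parity-⊕

parity-basis : ∀ {n} (s : Fin n) → parity (basis s) ≡ true
parity-basis {suc n} Fin.zero = cong not (parity-𝟎 n)
parity-basis (Fin.suc s)      = parity-basis s

-- Pairing with the s-th basis vector sums all coordinates of x except the s-th.
Γ-basis : ∀ {n} (x : Vec Bool n) s → Γ x (basis s) ≡ lookup x s xor parity x
Γ-basis {suc n} (a ∷ x) Fin.zero = trans
  (cong₂ (λ p g → ((a ∧ p) xor parity x) xor g) (parity-𝟎 n) (Γ-𝟎ʳ x))
  (solve 2 (λ a p → (a :* con false :+ p) :+ con false := a :+ (a :+ p)) refl a (parity x))
Γ-basis (a ∷ x) (Fin.suc s) = trans
  (cong₂ (λ p g → ((a ∧ p) xor false) xor g) (parity-basis s) (Γ-basis x s))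
  (solve 3 (λ a b p → (a :* con true :+ con false) :+ (b :+ p) := b :+ (a :+ p)) refl a (lookup x s) (parity x))

parity-ones : ∀ k → parity (replicate (k * 2) true) ≡ false
parity-ones zero    = refl
parity-ones (suc k) = cong (not ∘ not) (parity-ones k)

-- A vector orthogonal to every basis vector is constant, and the all-one vector of even length has parity 0.
Γ-dual : ∀ k (x : Vec Bool (k * 2)) → ¬ x ≡ 𝟎 → ∃ λ y → Γ x y ≡ true
Γ-dual k x x≢𝟎 with search (Γ x)
... | inj₁ found = found
... | inj₂ none  = contradiction x≡𝟎 x≢𝟎
  where
  constant : x ≡ replicate _ (parity x)
  constant = lookup-ext λ s → trans (xor-≡ (trans (sym (Γ-basis x s)) (none (basis s)))) (sym (Vec.lookup-replicate s (parity x)))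
  x≡𝟎 : x ≡ 𝟎
  x≡𝟎 with parity x in eq
  ... | false = trans constant (cong (replicate _) eq)
  ... | true  = contradiction (trans (sym eq) (trans (cong parity (trans constant (cong (replicate _) eq))) (parity-ones k))) λ ()

Γ-form : ∀ k → Symplectic (k * 2)
Γ-form k = record { B = Γ ; B-⊕ˡ = Γ-⊕ˡ ; B-sym = Γ-sym ; B-alt = Γ-alt ; B-dual = Γ-dual k }

indicator : Fin 4 → Fin 4 → ℕ → Bool
indicator i₁ i₂ w = (w ℕ.≡ᵇ toℕ i₁) ∨ (w ℕ.≡ᵇ toℕ i₂)

-- One of `i₁`, `i₂` is even and the other odd, so for either low digit p exactly one high digit s
-- is selected: the indicator is s plus a function of p, and every function of one bit is affine.
indicator-affine : ∀ i₁ i₂ → (toℕ i₁ + toℕ i₂) % 2 ≡ 1 →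
  ∃₂ λ ε η → ∀ p s → indicator i₁ i₂ (digits p s) ≡ ε xor ((η ∧ p) xor s)
indicator-affine i₁ i₂ odd = ε , η , table i₁ i₂ odd
  where
  ε = indicator i₁ i₂ 0
  η = indicator i₁ i₂ 1 xor indicator i₁ i₂ 0
  table : ∀ i₁ i₂ → (toℕ i₁ + toℕ i₂) % 2 ≡ 1 → ∀ p s → indicator i₁ i₂ (digits p s) ≡
    indicator i₁ i₂ 0 xor (((indicator i₁ i₂ 1 xor indicator i₁ i₂ 0) ∧ p) xor s)
  table 0F 1F _ = λ { true true → refl ; true false → refl ; false true → refl ; false false → refl }
  table 1F 0F _ = λ { true true → refl ; true false → refl ; false true → refl ; false false → refl }
  table 0F 3F _ = λ { true true → refl ; true false → refl ; false true → refl ; false false → refl }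
  table 3F 0F _ = λ { true true → refl ; true false → refl ; false true → refl ; false false → refl }
  table 1F 2F _ = λ { true true → refl ; true false → refl ; false true → refl ; false false → refl }
  table 2F 1F _ = λ { true true → refl ; true false → refl ; false true → refl ; false false → refl }
  table 2F 3F _ = λ { true true → refl ; true false → refl ; false true → refl ; false false → refl }
  table 3F 2F _ = λ { true true → refl ; true false → refl ; false true → refl ; false false → refl }
  table 0F 0F ()
  table 0F 2F ()
  table 2F 0F ()
  table 2F 2F ()
  table 1F 1F ()
  table 1F 3F ()
  table 3F 1F ()
  table 3F 3F ()

wt-indicator : ∀ {n} → Fin 4 → Fin 4 → Vec Bool n → Bool
wt-indicator i₁ i₂ x = indicator i₁ i₂ (weight (lookup x) % 4)

-- The linear part `η ∧ parity` cancels and only `pairs` contributes to the polar form. The term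
-- `q 𝟎` balances the constant ε, which is one exactly when `i₁` or `i₂` is 0.
wt-indicator-⊕ : ∀ {n} i₁ i₂ → (toℕ i₁ + toℕ i₂) % 2 ≡ 1 → (x y : Vec Bool n) → let q = wt-indicator i₁ i₂ in
  q (x ⊕ y) ≡ ((q x xor q y) xor q (𝟎 {n})) xor Γ x y
wt-indicator-⊕ {n} i₁ i₂ odd x y with indicator-affine i₁ i₂ odd
... | ε , η , affine = begin
  q (x ⊕ y)
    ≡⟨ q≡ (x ⊕ y) ⟩
  ε xor ((η ∧ parity (x ⊕ y)) xor pairs (x ⊕ y))
    ≡⟨ cong₂ (λ p s → ε xor ((η ∧ p) xor s)) (parity-⊕ x y) (pairs-⊕ x y) ⟩
  ε xor ((η ∧ (parity x xor parity y)) xor ((pairs x xor pairs y) xor Γ x y))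
    ≡⟨ solve 7 (λ e n p p' s s' g → e :+ ((n :* (p :+ p')) :+ ((s :+ s') :+ g)) :=
         (((e :+ (n :* p :+ s)) :+ (e :+ (n :* p' :+ s'))) :+ (e :+ (n :* con false :+ con false))) :+ g)
         refl ε η (parity x) (parity y) (pairs x) (pairs y) (Γ x y) ⟩
  (((ε xor ((η ∧ parity x) xor pairs x)) xor (ε xor ((η ∧ parity y) xor pairs y)))
    xor (ε xor ((η ∧ false) xor false))) xor Γ x y
    ≡⟨ cong (_xor Γ x y) (cong₂ _xor_ (cong₂ _xor_ (q≡ x) (q≡ y)) q𝟎) ⟨
  ((q x xor q y) xor q 𝟎) xor Γ x y ∎
  where
  open ≡-Reasoning
  q = wt-indicator i₁ i₂
  q≡ : ∀ z → q z ≡ ε xor ((η ∧ parity z) xor pairs z)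
  q≡ z = trans (cong (indicator i₁ i₂) (weight%4 z)) (affine (parity z) (pairs z))
  pairs-𝟎 : ∀ n → pairs {n} 𝟎 ≡ false
  pairs-𝟎 zero    = refl
  pairs-𝟎 (suc n) = pairs-𝟎 n
  q𝟎 : q 𝟎 ≡ ε xor ((η ∧ false) xor false)
  q𝟎 = trans (q≡ 𝟎) (cong₂ (λ p s → ε xor ((η ∧ p) xor s)) (parity-𝟎 n) (pairs-𝟎 n))

module _ {n} (S : Symplectic n) (2<n : 2 < n) where
  open Symplectic S hiding (B)

  -- For the value one, a partner of d is automatically nonzero and different from d. For the value
  -- zero, x is also made orthogonal to a partner y of d; d is not orthogonal to y, so x differs
  -- from d. These are two linear conditions, solvable nontrivially in dimension above 2.
  pairing-value : ∀ {d} → ¬ d ≡ 𝟎 → ∀ b → ∃ λ x → ¬ x ≡ 𝟎 × ¬ x ≡ d × B S x d ≡ b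
  pairing-value {d} d≢𝟎 b with B-dual d d≢𝟎
  pairing-value {d} d≢𝟎 true  | y , Bdy = y , B≡true⇒≢𝟎 Bdy , B≡true⇒≢ Bdy , trans (B-sym y d) Bdy
  pairing-value {d} d≢𝟎 false | y , Bdy =
    let x , x≢𝟎 , eq = kernel 2<n (λ x → B S x d ∷ B S x y ∷ [])
          (λ x z → cong₂ (λ a b → a ∷ b ∷ []) (B-⊕ˡ x z d) (B-⊕ˡ x z y))
    in x , x≢𝟎
     , (λ x≡d → contradiction (trans (sym Bdy) (trans (cong (λ v → B S v y) (sym x≡d)) (cong (λ v → lookup v 1F) eq))) λ ())
     , cong (λ v → lookup v 0F) eq

-- The Hamming code and the dual of C.

pair : ∀ {n} → (Fin n → Bool) → (Fin n → Bool) → Bool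
pair w c = ⨁ (λ i → w i ∧ c i)

pair-xor : ∀ {n} (w c c' : Fin n → Bool) → pair w (λ i → c i xor c' i) ≡ pair w c xor pair w c'
pair-xor w c c' = trans (⨁-cong (λ i → 𝔹.∧-distribˡ-xor (w i) (c i) (c' i))) (⨁-xor (λ i → w i ∧ c i) (λ i → w i ∧ c' i))

pair-∧ : ∀ {n} (w : Fin n → Bool) b c → pair w (λ i → b ∧ c i) ≡ b ∧ pair w c
pair-∧ w b c = trans
  (⨁-cong (λ i → solve 3 (λ w b c → w :* (b :* c) := b :* (w :* c)) refl (w i) b (c i)))
  (⨁-∧ˡ b (λ i → w i ∧ c i))

pair-xorˡ : ∀ {n} (w w' c : Fin n → Bool) → pair (λ i → w i xor w' i) c ≡ pair w c xor pair w' c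
pair-xorˡ w w' c = trans (⨁-cong (λ i → 𝔹.∧-distribʳ-xor (c i) (w i) (w' i))) (⨁-xor (λ i → w i ∧ c i) (λ i → w' i ∧ c i))

module Hamming {m n} (h : Fin n → BVec m) (hamming : IsHammingColumns h) where

  H : Fin n → Vec Bool m
  H i = tabulate (h i)

  H≢𝟎 : ∀ i → ¬ H i ≡ 𝟎
  H≢𝟎 i eq = proj₁ hamming i λ r → trans (sym (Vec.lookup∘tabulate (h i) r)) (trans (cong (λ x → lookup x r) eq) (lookup-𝟎 r))

  H-injective : ∀ {i j} → H i ≡ H j → i ≡ j
  H-injective {i} {j} eq = proj₁ (proj₂ hamming) i j λ r →
    trans (sym (Vec.lookup∘tabulate (h i) r)) (trans (cong (λ x → lookup x r) eq) (Vec.lookup∘tabulate (h j) r))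

  locate : ∀ x → ¬ x ≡ 𝟎 → ∃ λ i → H i ≡ x
  locate x x≢𝟎 =
    let i , eq = proj₂ (proj₂ hamming) (lookup x) (λ zero → x≢𝟎 (lookup-ext λ r → trans (zero r) (sym (lookup-𝟎 r))))
    in i , trans (Vec.tabulate-cong eq) (Vec.tabulate∘lookup x)

  abstract
    -- Positions correspond to nonzero vectors, so a family indexed by positions becomes a function
    -- on the whole space once a value at 𝟎 is chosen.
    extendBy : {A : Set} → A → (Fin n → A) → Vec Bool m → A
    extendBy a w x with x ≟ᵥ 𝟎
    ... | yes _  = a
    ... | no x≢𝟎 = w (proj₁ (locate x x≢𝟎))

    extendBy-𝟎 : ∀ {A : Set} (a : A) w → extendBy a w 𝟎 ≡ a
    extendBy-𝟎 a w with 𝟎 {m} ≟ᵥ 𝟎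
    ... | yes _  = refl
    ... | no 𝟎≢𝟎 = contradiction refl 𝟎≢𝟎

    extendBy-H : ∀ {A : Set} (a : A) w i → extendBy a w (H i) ≡ w i
    extendBy-H a w i with H i ≟ᵥ 𝟎
    ... | yes eq = contradiction eq (H≢𝟎 i)
    ... | no ne  = cong w (H-injective (proj₂ (locate (H i) ne)))

  H-elim : (P : Vec Bool m → Set) → P 𝟎 → (∀ i → P (H i)) → ∀ x → P x
  H-elim P P𝟎 PH x with x ≟ᵥ 𝟎
  ... | yes eq = subst P (sym eq) P𝟎
  ... | no ne  = let i , eq = locate x ne in subst P eq (PH i)

  does-H : ∀ i j → does (H i ≟ᵥ H j) ≡ does (i Fin.≟ j)
  does-H i j with H i ≟ᵥ H j | i Fin.≟ j
  ... | yes _  | yes _  = refl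
  ... | no _   | no _   = refl
  ... | yes eq | no ne  = contradiction (H-injective eq) ne
  ... | no ne  | yes eq = contradiction (cong H eq) ne

  -- At x = 𝟎 this is the zero word, as no column vanishes; `word` can therefore be written without
  -- separating cases.
  δ : Vec Bool m → Fin n → Bool
  δ x i = does (H i ≟ᵥ x)

  pair-δ : ∀ w x → pair w (δ x) ≡ extendBy false w x
  pair-δ w = H-elim _
    (trans (⨁-cong at-𝟎) (trans (⨁-false {n}) (sym (extendBy-𝟎 false w))))
    (λ j → trans (⨁-cong (λ i → cong (w i ∧_) (does-H i j))) (trans (⨁-δ w j) (sym (extendBy-H false w j))))
    where
    at-𝟎 : ∀ i → w i ∧ δ 𝟎 i ≡ false
    at-𝟎 i with H i ≟ᵥ 𝟎
    ... | yes eq = contradiction eq (H≢𝟎 i)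
    ... | no _   = 𝔹.∧-zeroʳ (w i)

  expand : (Vec Bool m → Bool) → Vec Bool m → Bool
  expand u x = ⨁ (λ r → lookup x r ∧ u (basis r))

  expand-functional : ∀ u → Functional (expand u)
  expand-functional u = functional-sum (λ r x → lookup x r ∧ u (basis r)) λ r x y →
    trans (cong (_∧ u (basis r)) (lookup-⊕ x y r)) (𝔹.∧-distribʳ-xor (u (basis r)) (lookup x r) (lookup y r))

  -- The word x + Σ x_r e_r, whose syndrome in the Hamming code vanishes.
  word : Vec Bool m → Fin n → Bool
  word x i = δ x i xor ⨁ (λ r → lookup x r ∧ δ (basis r) i)

  -- The deviation of w, extended by zero at 𝟎, from the functional with the same values on the
  -- basis. It measures how far w is from a combination of the Hamming rows.
  defect : (Fin n → Bool) → Vec Bool m → Bool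
  defect w x = extendBy false w x xor expand (extendBy false w) x

  pair-word : ∀ w x → pair w (word x) ≡ defect w x
  pair-word w x = begin
    pair w (word x)
      ≡⟨ pair-xor w (δ x) (λ i → ⨁ (λ r → lookup x r ∧ δ (basis r) i)) ⟩
    pair w (δ x) xor ⨁ (λ i → w i ∧ ⨁ (λ r → lookup x r ∧ δ (basis r) i))
      ≡⟨ cong (pair w (δ x) xor_) (⨁-cong (λ i → ⨁-∧ˡ (w i) (λ r → lookup x r ∧ δ (basis r) i))) ⟨
    pair w (δ x) xor ⨁ (λ i → ⨁ (λ r → w i ∧ lookup x r ∧ δ (basis r) i))
      ≡⟨ cong (pair w (δ x) xor_) (⨁-comm (λ i r → w i ∧ lookup x r ∧ δ (basis r) i)) ⟩
    pair w (δ x) xor ⨁ (λ r → pair w (λ i → lookup x r ∧ δ (basis r) i))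
      ≡⟨ cong₂ _xor_ (pair-δ w x) (⨁-cong (λ r → trans (pair-∧ w (lookup x r) (δ (basis r))) (cong (lookup x r ∧_) (pair-δ w (basis r))))) ⟩
    defect w x ∎
    where open ≡-Reasoning

  extendBy-functional : ∀ ℓ → Functional ℓ → ∀ x → extendBy false (ℓ ∘ H) x ≡ ℓ x
  extendBy-functional ℓ add = H-elim _ (trans (extendBy-𝟎 false (ℓ ∘ H)) (sym (functional-𝟎 ℓ add))) (extendBy-H false (ℓ ∘ H))

  defect-functional : ∀ ℓ → Functional ℓ → ∀ x → defect (ℓ ∘ H) x ≡ false
  defect-functional ℓ add x = trans
    (cong₂ _xor_ (trans (extendBy-functional ℓ add x) (functional-expand ℓ add x))
                 (⨁-cong (λ r → cong (lookup x r ∧_) (extendBy-functional ℓ add (basis r)))))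
    (𝔹.xor-same (expand ℓ x))

  module Code (q : Vec Bool m → Bool) where

    Codeword : (Fin n → Bool) → Set
    Codeword c = (∀ r → pair (λ i → h i r) c ≡ false) × pair (q ∘ H) c ≡ false

    -- `ℓ ∘ H` is the combination of the Hamming rows with coefficients `ℓ (basis r)`.
    pair-functional : ∀ {c} → Codeword c → ∀ ℓ → Functional ℓ → pair (ℓ ∘ H) c ≡ false
    pair-functional {c} (row , _) ℓ add = begin
      ⨁ (λ i → ℓ (H i) ∧ c i)
        ≡⟨ ⨁-cong (λ i → trans (cong (_∧ c i) (functional-expand ℓ add (H i))) (sym (⨁-∧ʳ (c i) (λ r → lookup (H i) r ∧ ℓ (basis r))))) ⟩
      ⨁ (λ i → ⨁ (λ r → (lookup (H i) r ∧ ℓ (basis r)) ∧ c i))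
        ≡⟨ ⨁-comm (λ i r → (lookup (H i) r ∧ ℓ (basis r)) ∧ c i) ⟩
      ⨁ (λ r → ⨁ (λ i → (lookup (H i) r ∧ ℓ (basis r)) ∧ c i))
        ≡⟨ ⨁-cong (λ r → trans (⨁-cong (λ i → rearrange r i)) (trans (⨁-∧ˡ (ℓ (basis r)) (λ i → h i r ∧ c i))
             (trans (cong (ℓ (basis r) ∧_) (row r)) (𝔹.∧-zeroʳ (ℓ (basis r)))))) ⟩
      ⨁ {m} (λ _ → false)
        ≡⟨ ⨁-false {m} ⟩
      false ∎
      where
      open ≡-Reasoning
      rearrange : ∀ r i → (lookup (H i) r ∧ ℓ (basis r)) ∧ c i ≡ ℓ (basis r) ∧ (h i r ∧ c i)
      rearrange r i rewrite Vec.lookup∘tabulate (h i) r =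
        solve 3 (λ a b c → (a :* b) :* c := b :* (a :* c)) refl (h i r) (ℓ (basis r)) (c i)

    -- The dual of the code is spanned by the rows of the parity check matrix:
    -- the words x + Σ x_r e_r, corrected by a fixed one of odd pairing with
    -- the last row (if there is one), are codewords.
    abstract
      dual-span : ∀ w → (∀ c → Codeword c → pair w c ≡ false) →
                  ∃₂ λ ℓ a → Functional ℓ × (∀ i → w i ≡ ℓ (H i) xor (a ∧ q (H i)))
      dual-span w w⊥ = ℓ , a , ℓ-functional , w≡
        where
        open ≡-Reasoning
        D : Vec Bool m → Bool
        D = defect (q ∘ H)
        corrector : ∃ λ x₀ → ∀ x → D x xor (D x ∧ D x₀) ≡ false
        corrector with search D
        ... | inj₁ (x₀ , eq) = x₀ , λ x → trans (cong (λ b → D x xor (D x ∧ b)) eq) (trans (cong (D x xor_) (𝔹.∧-identityʳ (D x))) (𝔹.xor-same (D x)))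
        -- Here every `word x` is already a codeword and the correction has coefficient zero; 𝟎 is a
        -- dummy.
        ... | inj₂ none      = 𝟎 , λ x → cong (λ b → b xor (b ∧ D 𝟎)) (none x)
        x₀ : Vec Bool m
        x₀ = proj₁ corrector
        corrected : Vec Bool m → Fin n → Bool
        corrected x i = word x i xor (D x ∧ word x₀ i)
        pair-corrected : ∀ u x → pair u (corrected x) ≡ defect u x xor (D x ∧ defect u x₀)
        pair-corrected u x = trans (pair-xor u (word x) (λ i → D x ∧ word x₀ i))
          (cong₂ _xor_ (pair-word u x) (trans (pair-∧ u (D x) (word x₀)) (cong (D x ∧_) (pair-word u x₀))))
        codeword : ∀ x → Codeword (corrected x)
        codeword x = row , trans (pair-corrected (q ∘ H) x) (proj₂ corrector x)
          where
          row : ∀ r → pair (λ i → h i r) (corrected x) ≡ false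
          row r = begin
            pair (λ i → h i r) (corrected x)
              ≡⟨ ⨁-cong (λ i → cong (_∧ corrected x i) (Vec.lookup∘tabulate (h i) r)) ⟨
            pair (coord ∘ H) (corrected x)
              ≡⟨ pair-corrected (coord ∘ H) x ⟩
            defect (coord ∘ H) x xor (D x ∧ defect (coord ∘ H) x₀)
              ≡⟨ cong₂ (λ b c → b xor (D x ∧ c)) (defect-functional coord coord-functional x) (defect-functional coord coord-functional x₀) ⟩
            D x ∧ false
              ≡⟨ 𝔹.∧-zeroʳ (D x) ⟩
            false ∎
            where
            coord : Vec Bool m → Bool
            coord y = lookup y r
            coord-functional : Functional coord
            coord-functional y z = lookup-⊕ y z r
        -- Orthogonality of w to the corrected words says that `defect w x` equals `a ∧ D x`. Thus w
        -- + a q has no defect, and ℓ is the functional with its basis values.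
        a : Bool
        a = defect w x₀
        ℓ : Vec Bool m → Bool
        ℓ x = expand (extendBy false w) x xor (a ∧ expand (extendBy false (q ∘ H)) x)
        ℓ-functional : Functional ℓ
        ℓ-functional x y = trans
          (cong₂ (λ b c → b xor (a ∧ c)) (expand-functional (extendBy false w) x y) (expand-functional (extendBy false (q ∘ H)) x y))
          (solve 5 (λ a p q r s → (p :+ q) :+ a :* (r :+ s) := (p :+ a :* r) :+ (q :+ a :* s)) refl a
            (expand (extendBy false w) x) (expand (extendBy false w) y)
            (expand (extendBy false (q ∘ H)) x) (expand (extendBy false (q ∘ H)) y))
        w≡ : ∀ i → w i ≡ ℓ (H i) xor (a ∧ q (H i))
        w≡ i = xor-≡ (begin
          w i xor (ℓ (H i) xor (a ∧ q (H i)))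
            ≡⟨ cong₂ (λ b c → b xor (ℓ (H i) xor (a ∧ c))) (extendBy-H false w i) (extendBy-H false (q ∘ H) i) ⟨
          ŵ xor (ℓ (H i) xor (a ∧ q̂))
            ≡⟨ solve 5 (λ u e a v f → u :+ ((e :+ a :* f) :+ a :* v) := (u :+ e) :+ ((v :+ f) :* a)) refl
                 ŵ (expand (extendBy false w) (H i)) a q̂ (expand (extendBy false (q ∘ H)) (H i)) ⟩
          defect w (H i) xor (D (H i) ∧ a)
            ≡⟨ pair-corrected w (H i) ⟨
          pair w (corrected (H i))
            ≡⟨ w⊥ _ (codeword (H i)) ⟩
          false ∎)
          where
          ŵ q̂ : Bool
          ŵ = extendBy false w (H i)
          q̂ = extendBy false (q ∘ H) (H i)

-- Let the action be x ↦ L x + q(x) a with L linear. A collision of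
-- (t , x) ↦ t a + L x gives d with L d = t a; unless a = 0, the bilinearity of
-- the polar form Γ of q yields x outside {0 , d} with q (x + d) = q x + t, and
-- x and x + d have the same image.
module Automorphisms (k : ℕ) (2<m : 2 < k * 2) {n} (h : Fin n → BVec (k * 2)) (hamming : IsHammingColumns h)
  (q : Vec Bool (k * 2) → Bool) (q-⊕ : ∀ x y → q (x ⊕ y) ≡ ((q x xor q y) xor q 𝟎) xor Γ x y) where

  private
    m = k * 2

  open Hamming h hamming
  open Code q
  open Symplectic (Γ-form k) hiding (B)

  act : (Fin n → Fin n) → Vec Bool m → Vec Bool m
  act σ = extendBy 𝟎 (H ∘ σ)

  act-H : ∀ σ i → act σ (H i) ≡ H (σ i)
  act-H σ = extendBy-H 𝟎 (H ∘ σ)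

  act-𝟎 : ∀ σ → act σ 𝟎 ≡ 𝟎
  act-𝟎 σ = extendBy-𝟎 𝟎 (H ∘ σ)

  act-∘ : ∀ σ τ x → act (σ ∘ τ) x ≡ act σ (act τ x)
  act-∘ σ τ = H-elim _
    (trans (act-𝟎 (σ ∘ τ)) (sym (trans (cong (act σ) (act-𝟎 τ)) (act-𝟎 σ))))
    (λ i → trans (act-H (σ ∘ τ) i) (sym (trans (cong (act σ) (act-H τ i)) (act-H σ (τ i)))))

  act-id : ∀ σ → (∀ i → σ i ≡ i) → ∀ x → act σ x ≡ x
  act-id σ σ≡ = H-elim _ (act-𝟎 σ) (λ i → trans (act-H σ i) (cong H (σ≡ i)))

  act-cong : ∀ σ τ → (∀ i → σ i ≡ τ i) → ∀ x → act σ x ≡ act τ x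
  act-cong σ τ eq = H-elim _ (trans (act-𝟎 σ) (sym (act-𝟎 τ)))
    (λ i → trans (act-H σ i) (trans (cong H (eq i)) (sym (act-H τ i))))

  module Linearity (σ τ : Fin n → Fin n) (σ∘τ : ∀ i → σ (τ i) ≡ i) (τ∘σ : ∀ i → τ (σ i) ≡ i)
    (preserves : ∀ c → Codeword c → Codeword (c ∘ σ)) where

    f g : Vec Bool m → Vec Bool m
    f = act τ
    g = act σ

    f∘g : ∀ x → f (g x) ≡ x
    f∘g x = trans (sym (act-∘ τ σ x)) (act-id (τ ∘ σ) τ∘σ x)

    g∘f : ∀ x → g (f x) ≡ x
    g∘f x = trans (sym (act-∘ σ τ x)) (act-id (σ ∘ τ) σ∘τ x)

    f-injective : ∀ {x y} → f x ≡ f y → x ≡ y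
    f-injective {x} {y} eq = trans (sym (g∘f x)) (trans (cong g eq) (g∘f y))

    f-≢𝟎 : ∀ {x} → ¬ x ≡ 𝟎 → ¬ f x ≡ 𝟎
    f-≢𝟎 x≢𝟎 eq = x≢𝟎 (f-injective (trans eq (sym (act-𝟎 τ))))

    g-≢𝟎 : ∀ {x} → ¬ x ≡ 𝟎 → ¬ g x ≡ 𝟎
    g-≢𝟎 {x} x≢𝟎 eq = x≢𝟎 (trans (sym (f∘g x)) (trans (cong f eq) (act-𝟎 τ)))

    -- Pairing w with `c ∘ σ` amounts to pairing `w ∘ τ` with c, so the dual of the code is stable
    -- under composition with the inverse permutation. This is why f is the action of τ.
    row∘τ : ∀ w → (∀ c → Codeword c → pair w c ≡ false) →
            ∃₂ λ ℓ a → Functional ℓ × (∀ i → w (τ i) ≡ ℓ (H i) xor (a ∧ q (H i)))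
    row∘τ w w⊥ = dual-span (w ∘ τ) λ c cc → begin
      ⨁ (λ i → w (τ i) ∧ c i)             ≡⟨ ⨁-permute (λ i → w (τ i) ∧ c i) (mk↔ₛ′ σ τ σ∘τ τ∘σ) ⟩
      ⨁ (λ i → w (τ (σ i)) ∧ c (σ i))     ≡⟨ ⨁-cong (λ i → cong (λ j → w j ∧ c (σ i)) (τ∘σ i)) ⟩
      ⨁ (λ i → w i ∧ c (σ i))             ≡⟨ w⊥ (c ∘ σ) (preserves c cc) ⟩
      false                               ∎
      where open ≡-Reasoning

    private
      coordinate = λ r → row∘τ (λ i → h i r) (λ c cc → proj₁ cc r)

      L : Vec Bool m → Vec Bool m
      L x = tabulate (λ r → proj₁ (coordinate r) x)

      a : Vec Bool m
      a = tabulate (λ r → proj₁ (proj₂ (coordinate r)))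

      L-additive : Additive L
      L-additive x y = lookup-ext λ r → begin
        lookup (L (x ⊕ y)) r            ≡⟨ Vec.lookup∘tabulate _ r ⟩
        proj₁ (coordinate r) (x ⊕ y)    ≡⟨ proj₁ (proj₂ (proj₂ (coordinate r))) x y ⟩
        proj₁ (coordinate r) x xor proj₁ (coordinate r) y
          ≡⟨ cong₂ _xor_ (Vec.lookup∘tabulate (λ r → proj₁ (coordinate r) x) r) (Vec.lookup∘tabulate (λ r → proj₁ (coordinate r) y) r) ⟨
        lookup (L x) r xor lookup (L y) r ≡⟨ lookup-⊕ (L x) (L y) r ⟨
        lookup (L x ⊕ L y) r            ∎
        where open ≡-Reasoning

      -- Coordinate r of the column at `τ i` is row r composed with τ, and such a row lies in the
      -- dual of the code. The formula is confined to x ≠ 𝟎: f fixes 𝟎, while `q 𝟎` may be one.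
      f-affine : ∀ x → ¬ x ≡ 𝟎 → f x ≡ L x ⊕ q x · a
      f-affine = H-elim _ (λ 𝟎≢𝟎 → contradiction refl 𝟎≢𝟎) λ i _ → trans (act-H τ i) (lookup-ext λ r → begin
        lookup (H (τ i)) r
          ≡⟨ Vec.lookup∘tabulate (h (τ i)) r ⟩
        h (τ i) r
          ≡⟨ proj₂ (proj₂ (proj₂ (coordinate r))) i ⟩
        proj₁ (coordinate r) (H i) xor (proj₁ (proj₂ (coordinate r)) ∧ q (H i))
          ≡⟨ cong₂ _xor_ (Vec.lookup∘tabulate (λ r → proj₁ (coordinate r) (H i)) r)
               (trans (lookup-· (q (H i)) a r) (trans (cong (q (H i) ∧_) (Vec.lookup∘tabulate _ r)) (𝔹.∧-comm (q (H i)) _))) ⟨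
        lookup (L (H i)) r xor lookup (q (H i) · a) r
          ≡⟨ lookup-⊕ (L (H i)) (q (H i) · a) r ⟨
        lookup (L (H i) ⊕ q (H i) · a) r ∎)
        where open ≡-Reasoning

      translate : Vec Bool (suc m) → Vec Bool m
      translate (t ∷ x) = t · a ⊕ L x

      translate-additive : Additive translate
      translate-additive (t ∷ x) (s ∷ y) = trans (cong₂ _⊕_ (·-xor t s a) (L-additive x y)) (⊕-medial (t · a) (s · a) (L x) (L y))

      no-collision : ∀ t d → ¬ d ≡ 𝟎 → ¬ L d ≡ t · a
      no-collision t d d≢𝟎 Ld =
        -- The prescribed pairing is the one that solves q(x + d) = q(x) + t for Γ(x, d). Both x and
        -- x + d must be nonzero for `f-affine` to apply.
        let x , x≢𝟎 , x≢d , Γxd = pairing-value (Γ-form k) 2<m d≢𝟎 ((q d xor q 𝟎) xor t)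
            q≡ : q (x ⊕ d) ≡ t xor q x
            q≡ = trans (q-⊕ x d) (trans (cong (((q x xor q d) xor q 𝟎) xor_) Γxd)
              (solve 4 (λ a b c t → ((a :+ b) :+ c) :+ ((b :+ c) :+ t) := t :+ a) refl (q x) (q d) (q 𝟎) t))
            same : f (x ⊕ d) ≡ f x
            same = begin
              f (x ⊕ d)                               ≡⟨ f-affine (x ⊕ d) (λ eq → x≢d (⊕-≡𝟎 eq)) ⟩
              L (x ⊕ d) ⊕ q (x ⊕ d) · a               ≡⟨ cong₂ _⊕_ (L-additive x d) (cong (_· a) q≡) ⟩
              (L x ⊕ L d) ⊕ (t xor q x) · a           ≡⟨ cong₂ _⊕_ (cong (L x ⊕_) Ld) (·-xor t (q x) a) ⟩
              (L x ⊕ t · a) ⊕ (t · a ⊕ q x · a)       ≡⟨ ⊕-assoc (L x ⊕ t · a) (t · a) (q x · a) ⟨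
              ((L x ⊕ t · a) ⊕ t · a) ⊕ q x · a       ≡⟨ cong (_⊕ q x · a) (⊕-cancelʳ (L x) (t · a)) ⟩
              L x ⊕ q x · a                           ≡⟨ f-affine x x≢𝟎 ⟨
              f x                                     ∎
        in d≢𝟎 (trans (sym (⊕-cancelˡ x d)) (trans (cong (x ⊕_) (f-injective same)) (⊕-self x)))
        where open ≡-Reasoning

      a≡𝟎 : a ≡ 𝟎
      a≡𝟎 with kernel (ℕ.n<1+n m) translate translate-additive
      ... | t ∷ d , td≢𝟎 , eq with d ≟ᵥ 𝟎
      ... | no d≢𝟎   = contradiction (sym (⊕-≡𝟎 eq)) (no-collision t d d≢𝟎)
      a≡𝟎 | false ∷ d , td≢𝟎 , eq | yes refl = contradiction refl td≢𝟎
      -- With d = 𝟎 the kernel relation reads a + L 𝟎 = 𝟎, which is already the claim.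
      a≡𝟎 | true ∷ d , td≢𝟎 , eq | yes refl =
        trans (sym (⊕-identityʳ a)) (trans (cong (a ⊕_) (sym (additive-𝟎 L L-additive))) eq)

      f≡L : ∀ x → f x ≡ L x
      f≡L x with x ≟ᵥ 𝟎
      ... | yes refl = trans (act-𝟎 τ) (sym (additive-𝟎 L L-additive))
      ... | no x≢𝟎   = trans (f-affine x x≢𝟎) (trans (cong (L x ⊕_) (trans (cong (q x ·_) a≡𝟎) (·-𝟎 (q x)))) (⊕-identityʳ (L x)))
        where
        ·-𝟎 : ∀ b → b · 𝟎 {m} ≡ 𝟎
        ·-𝟎 true  = refl
        ·-𝟎 false = refl

      f-additive : Additive f
      f-additive x y = trans (f≡L (x ⊕ y)) (trans (L-additive x y) (sym (cong₂ _⊕_ (f≡L x) (f≡L y))))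

      last-row = row∘τ (q ∘ H) (λ c cc → proj₂ cc)
      ℓ = proj₁ last-row
      c = proj₁ (proj₂ last-row)
      ℓ-functional = proj₁ (proj₂ (proj₂ last-row))

      q∘f : ∀ x → ¬ x ≡ 𝟎 → q (f x) ≡ ℓ x xor (c ∧ q x)
      q∘f = H-elim _ (λ 𝟎≢𝟎 → contradiction refl 𝟎≢𝟎) λ i _ → trans (cong q (act-H τ i)) (proj₂ (proj₂ (proj₂ last-row)) i)

      q-polar : ∀ x y → Γ x y ≡ ((q x xor q y) xor q 𝟎) xor q (x ⊕ y)
      q-polar x y = trans
        (solve 2 (λ p g → g := p :+ (p :+ g)) refl ((q x xor q y) xor q 𝟎) (Γ x y))
        (cong (((q x xor q y) xor q 𝟎) xor_) (sym (q-⊕ x y)))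

      -- Polarises q(f x) = ℓ(x) + c q(x) at x, y and x + y, all three nonzero by hypothesis; ℓ
      -- cancels. The last `q 𝟎` carries no factor c because it stems from the polar identity at f x
      -- and f y.
      Γ∘f : ∀ x y → ¬ x ≡ 𝟎 → ¬ y ≡ 𝟎 → ¬ x ≡ y → Γ (f x) (f y) ≡ (c ∧ (Γ x y xor q 𝟎)) xor q 𝟎
      Γ∘f x y x≢𝟎 y≢𝟎 x≢y = begin
        Γ (f x) (f y)
          ≡⟨ q-polar (f x) (f y) ⟩
        ((q (f x) xor q (f y)) xor q 𝟎) xor q (f x ⊕ f y)
          ≡⟨ cong₂ (λ u v → (u xor q 𝟎) xor v) (cong₂ _xor_ (q∘f x x≢𝟎) (q∘f y y≢𝟎))
               (trans (cong q (sym (f-additive x y))) (trans (q∘f (x ⊕ y) (x≢y ∘ ⊕-≡𝟎))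
                 (cong₂ (λ u v → u xor (c ∧ v)) (ℓ-functional x y) (q-⊕ x y)))) ⟩
        (((ℓ x xor (c ∧ q x)) xor (ℓ y xor (c ∧ q y))) xor q 𝟎)
          xor ((ℓ x xor ℓ y) xor (c ∧ (((q x xor q y) xor q 𝟎) xor Γ x y)))
          ≡⟨ solve 7 (λ l l' c p p' e g →
               (((l :+ c :* p) :+ (l' :+ c :* p')) :+ e) :+ ((l :+ l') :+ c :* (((p :+ p') :+ e) :+ g)) :=
               c :* (g :+ e) :+ e) refl (ℓ x) (ℓ y) c (q x) (q y) (q 𝟎) (Γ x y) ⟩
        (c ∧ (Γ x y xor q 𝟎)) xor q 𝟎 ∎
        where open ≡-Reasoning

      -- For c = 0 the form Γ would take the constant value `q 𝟎` on images of distinct nonzero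
      -- vectors, but the opposite value occurs as well.
      c≡true : c ≡ true
      c≡true with c in eq
      ... | true  = refl
      ... | false =
        -- The kernel of a zero map merely supplies some nonzero d.
        let d , d≢𝟎 , _ = kernel 2<m (λ _ → 𝟎) (λ _ _ → refl)
            z , z≢𝟎 , z≢fd , Γz = pairing-value (Γ-form k) 2<m (f-≢𝟎 d≢𝟎) (not (q 𝟎))
            Γ≡ : Γ z (f d) ≡ q 𝟎
            Γ≡ = trans (cong (λ v → Γ v (f d)) (sym (f∘g z)))
              (trans (Γ∘f (g z) d (g-≢𝟎 z≢𝟎) d≢𝟎 (λ e → z≢fd (trans (sym (f∘g z)) (cong f e))))
                (cong (λ b → (b ∧ (Γ (g z) d xor q 𝟎)) xor q 𝟎) eq))
        in contradiction (trans (sym Γz) Γ≡) (𝔹.not-¬ refl ∘ sym)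

    f-Γ : ∀ x y → Γ (f x) (f y) ≡ Γ x y
    f-Γ x y with x ≟ᵥ 𝟎 | y ≟ᵥ 𝟎 | x ≟ᵥ y
    ... | yes refl | _        | _        = trans (cong (λ v → Γ v (f y)) (act-𝟎 τ)) (trans (B-𝟎ˡ (f y)) (sym (B-𝟎ˡ y)))
    ... | no _     | yes refl | _        = trans (cong (Γ (f x)) (act-𝟎 τ)) (trans (B-𝟎ʳ (f x)) (sym (B-𝟎ʳ x)))
    ... | no _     | no _     | yes refl = trans (B-alt (f x)) (sym (B-alt x))
    ... | no x≢𝟎   | no y≢𝟎   | no x≢y   = trans (Γ∘f x y x≢𝟎 y≢𝟎 x≢y)
      (trans (cong (λ b → (b ∧ (Γ x y xor q 𝟎)) xor q 𝟎) c≡true)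
        (solve 2 (λ g e → (g :+ e) :+ e := g) refl (Γ x y) (q 𝟎)))

    -- Inverting turns the action of τ into that of σ, so that composition of automorphisms is
    -- respected in the given order.
    isometry : Isometry (Γ-form k) (Γ-form k)
    isometry = record { to = f ; from = g ; to-from = f∘g ; from-to = g∘f ; to-B = f-Γ } ⁻¹

  -- From isometries of Γ back to automorphisms.

  permute : Isometry (Γ-form k) (Γ-form k) → Fin n → Fin n
  permute g i = proj₁ (locate (to g (H i)) (Isometry.to-≢𝟎 g (H≢𝟎 i)))

  H-permute : ∀ g i → H (permute g i) ≡ to g (H i)
  H-permute g i = proj₂ (locate (to g (H i)) (Isometry.to-≢𝟎 g (H≢𝟎 i)))

  permute-inverse : ∀ g i → permute g (permute (g ⁻¹) i) ≡ i
  permute-inverse g i = H-injective (trans (H-permute g _) (trans (cong (to g) (H-permute (g ⁻¹) i)) (to-from g (H i))))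

  permute-injective : ∀ g → Injective _≡_ _≡_ (permute g)
  permute-injective g {i} {j} eq =
    trans (sym (permute-inverse (g ⁻¹) i)) (trans (cong (permute (g ⁻¹)) eq) (permute-inverse (g ⁻¹) j))

  permute-preserves : ∀ g c → Codeword c → Codeword (c ∘ permute g)
  permute-preserves g c cc = row , last
    where
    open ≡-Reasoning
    pair-∘ : ∀ u → pair (u ∘ H) (c ∘ permute g) ≡ pair (λ i → u (from g (H i))) c
    pair-∘ u = begin
      ⨁ (λ i → u (H i) ∧ c (permute g i))
        ≡⟨ ⨁-permute (λ i → u (H i) ∧ c (permute g i)) (mk↔ₛ′ (permute (g ⁻¹)) (permute g) (permute-inverse (g ⁻¹)) (permute-inverse g)) ⟩
      ⨁ (λ i → u (H (permute (g ⁻¹) i)) ∧ c (permute g (permute (g ⁻¹) i)))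
        ≡⟨ ⨁-cong (λ i → cong₂ (λ v j → u v ∧ c j) (H-permute (g ⁻¹) i) (permute-inverse g i)) ⟩
      ⨁ (λ i → u (from g (H i)) ∧ c i) ∎

    from-additive : Additive (from g)
    from-additive = Isometry.to-additive (g ⁻¹)

    row : ∀ r → pair (λ i → h i r) (c ∘ permute g) ≡ false
    row r = begin
      pair (λ i → h i r) (c ∘ permute g)
        ≡⟨ ⨁-cong (λ i → cong (_∧ c (permute g i)) (Vec.lookup∘tabulate (h i) r)) ⟨
      pair (λ i → lookup (H i) r) (c ∘ permute g)
        ≡⟨ pair-∘ (λ x → lookup x r) ⟩
      pair (λ i → lookup (from g (H i)) r) c
        ≡⟨ pair-functional cc (λ x → lookup (from g x) r) (functional-lookup (from g) from-additive r) ⟩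
      false ∎

    difference : Vec Bool m → Bool
    difference x = q (from g x) xor q x

    -- `q ∘ from g` and q have the same polar form Γ and the same constant `q 𝟎`, and both cancel in
    -- the sum.
    difference-functional : Functional difference
    difference-functional x y = begin
      q (from g (x ⊕ y)) xor q (x ⊕ y)
        ≡⟨ cong₂ _xor_ (trans (cong q (from-additive x y)) (q-⊕ (from g x) (from g y))) (q-⊕ x y) ⟩
      (((q (from g x) xor q (from g y)) xor q 𝟎) xor Γ (from g x) (from g y)) xor (((q x xor q y) xor q 𝟎) xor Γ x y)
        ≡⟨ cong (λ b → (((q (from g x) xor q (from g y)) xor q 𝟎) xor b) xor (((q x xor q y) xor q 𝟎) xor Γ x y)) (Isometry.from-B g x y) ⟩
      (((q (from g x) xor q (from g y)) xor q 𝟎) xor Γ x y) xor (((q x xor q y) xor q 𝟎) xor Γ x y)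
        ≡⟨ solve 6 (λ a b e g c d → (((a :+ b) :+ e) :+ g) :+ (((c :+ d) :+ e) :+ g) := (a :+ c) :+ (b :+ d)) refl
             (q (from g x)) (q (from g y)) (q 𝟎) (Γ x y) (q x) (q y) ⟩
      difference x xor difference y ∎

    last : pair (q ∘ H) (c ∘ permute g) ≡ false
    last = begin
      pair (q ∘ H) (c ∘ permute g)
        ≡⟨ pair-∘ q ⟩
      pair (λ i → q (from g (H i))) c
        ≡⟨ ⨁-cong (λ i → cong (_∧ c i) (solve 2 (λ a b → a := (a :+ b) :+ b) refl (q (from g (H i))) (q (H i)))) ⟩
      pair (λ i → difference (H i) xor q (H i)) c
        ≡⟨ pair-xorˡ (difference ∘ H) (q ∘ H) c ⟩
      pair (difference ∘ H) c xor pair (q ∘ H) c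
        ≡⟨ cong₂ _xor_ (pair-functional cc difference difference-functional) (proj₂ cc) ⟩
      false ∎

-- Assembly of the isomorphism and the order.

Aut-setoid : ∀ {m n} (h : Fin n → BVec m) (i₁ i₂ : Fin 4) → Setoid 0ℓ 0ℓ
Aut-setoid h i₁ i₂ = record
  { Carrier = Aut h i₁ i₂
  ; _≈_ = _≈Aut_
  ; isEquivalence = record
    { refl = λ _ → refl ; sym = λ eq i → sym (eq i) ; trans = λ p q i → trans (p i) (q i) }
  }

module _ (k : ℕ) (2<m : 2 < k * 2) {n} (h : Fin n → BVec (k * 2)) (hamming : IsHammingColumns h)
  (i₁ i₂ : Fin 4) (odd : (toℕ i₁ + toℕ i₂) % 2 ≡ 1) where

  private
    q : Vec Bool (k * 2) → Bool
    q = wt-indicator i₁ i₂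

  open Automorphisms k 2<m h hamming q (wt-indicator-⊕ i₁ i₂ odd)
  open Hamming h hamming
  open Code q

  private
    weight-cong : ∀ {m} {x y : BVec m} → (∀ i → x i ≡ y i) → weight x ≡ weight y
    weight-cong {zero}  eq = refl
    weight-cong {suc m} eq = cong₂ (λ b w → (if b then 1 else 0) + w) (eq Fin.zero) (weight-cong (eq ∘ Fin.suc))

    vRow≡q : ∀ i → vRow h i₁ i₂ i ≡ q (H i)
    vRow≡q i = cong (λ w → indicator i₁ i₂ (w % 4)) (weight-cong (λ r → sym (Vec.lookup∘tabulate (h i) r)))

    pair-vRow : ∀ c → pair (vRow h i₁ i₂) c ≡ pair (q ∘ H) c
    pair-vRow c = ⨁-cong (λ i → cong (_∧ c i) (vRow≡q i))

    InCode⇒Codeword : ∀ {c} → InCode h i₁ i₂ c → Codeword c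
    InCode⇒Codeword {c} (rows , last) = rows , trans (sym (pair-vRow c)) last

    Codeword⇒InCode : ∀ {c} → Codeword c → InCode h i₁ i₂ c
    Codeword⇒InCode {c} (rows , last) = rows , trans (pair-vRow c) last

  -- Automorphisms are given as injective maps; finiteness supplies the two-sided inverse on which
  -- the linearity argument rests.
  Aut→isometry : Aut h i₁ i₂ → Isometry (Γ-form k) (Γ-form k)
  Aut→isometry (σ , σ-injective , preserves) = Linearity.isometry σ (λ i → proj₁ (onto i)) (λ i → proj₂ (onto i))
    (λ i → σ-injective (proj₂ (onto (σ i)))) (λ c → InCode⇒Codeword ∘ preserves c ∘ Codeword⇒InCode)
    where
    onto = fin-surjective σ σ-injective

  Aut→isometry-∘ : ∀ a b → Aut→isometry (a ∘Aut b) ≗ᵢ (Aut→isometry a ∙ Aut→isometry b)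
  Aut→isometry-∘ (σ , _) (τ , _) = act-∘ σ τ

  Aut↔isometries : Inverse (Aut-setoid h i₁ i₂) (isometries (Γ-form k) (Γ-form k))
  Aut↔isometries = record
    { to        = Aut→isometry
    ; from      = λ g → permute g , permute-injective g , λ c → Codeword⇒InCode ∘ permute-preserves g c ∘ InCode⇒Codeword
    ; to-cong   = λ { {σ , _} {τ , _} eq → act-cong σ τ eq }
    ; from-cong = λ {g} {g'} eq i → H-injective (trans (H-permute g i) (trans (eq (H i)) (sym (H-permute g' i))))
    ; inverse   = (λ { {g} {σ , _} eq → H-elim _
                         (trans (act-𝟎 σ) (sym (additive-𝟎 (to g) (Isometry.to-additive g))))
                         (λ i → trans (act-H σ i) (trans (cong H (eq i)) (H-permute g i))) })
                , (λ { {σ , _} {g} eq i → H-injective (trans (H-permute g i) (trans (eq (H i)) (act-H σ i))) })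
    }

theorem2p1 : (m k : ℕ) → m ≡ 2 * k → 4 ≤ m →
    (h : Fin (2 ^ m ∸ 1) → BVec m) → IsHammingColumns h →
    (i₁ i₂ : Fin 4) → (toℕ i₁ + toℕ i₂) % 2 ≡ 1 →
    (G : Mat m) → Alternating G → Nondegenerate G →
    AutIsoSp h i₁ i₂ G × HasCard (Aut h i₁ i₂) _≈Aut_ (spOrder k)
theorem2p1 m k m≡2k 4≤m h hamming i₁ i₂ odd G alternating nondegenerate with trans m≡2k (ℕ.*-comm 2 k)
... | refl = record
      { to        = E.to
      ; from      = E.from
      ; to-cong   = λ a b → E.to-cong {a} {b}
      ; from-cong = λ s t → E.from-cong {s} {t}
      ; to-from   = E.strictlyInverseˡ
      ; from-to   = E.strictlyInverseʳ
      ; homo      = homo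
      }
    , (N.from , N.to , N.strictlyInverseˡ , N.strictlyInverseʳ , λ a b → N.to-cong {a} {b})
  where
  2<m : 2 < k * 2
  2<m = ℕ.≤-trans (ℕ.n≤1+n 3) 4≤m

  S : Symplectic (k * 2)
  S = form G alternating nondegenerate

  Γ→S : Isometry (Γ-form k) S
  Γ→S = classification k S ∙ classification k (Γ-form k) ⁻¹

  Aut↔Γ : Inverse (Aut-setoid h i₁ i₂) (isometries (Γ-form k) (Γ-form k))
  Aut↔Γ = Aut↔isometries k 2<m h hamming i₁ i₂ odd

  -- Two routes lead out of the isometries of Γ: through G to matrices for the isomorphism, and
  -- through the standard form to the count.
  module E = Inverse (Comp.inverse Aut↔Γ (Comp.inverse (conjugation Γ→S) (isometries↔Sp G alternating nondegenerate)))
  module N = Inverse (Comp.inverse Aut↔Γ (Comp.inverse (conjugation (classification k (Γ-form k) ⁻¹)) (card-isometries k)))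

  homo : ∀ a b → proj₁ (E.to (a ∘Aut b)) ≈M (proj₁ (E.to a) ⊛ proj₁ (E.to b))
  -- Between the two conjugated factors `from Γ→S` and `to Γ→S` cancel; the matrix of a composite is
  -- then the product of the matrices.
  homo a b i j = trans
    (cong (λ x → lookup x i) (trans (cong (to Γ→S) (Aut→isometry-∘ k 2<m h hamming i₁ i₂ odd a b (from Γ→S (basis j))))
      (cong (to (Γ→S ∙ A)) (sym (from-to Γ→S _)))))
    (matrix-∘ (to (Γ→S ∙ A ∙ Γ→S ⁻¹)) (to (Γ→S ∙ A' ∙ Γ→S ⁻¹)) (Isometry.to-additive (Γ→S ∙ A ∙ Γ→S ⁻¹)) i j)
    where
    A A' : Isometry (Γ-form k) (Γ-form k)
    A = Aut→isometry k 2<m h hamming i₁ i₂ odd a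
    A' = Aut→isometry k 2<m h hamming i₁ i₂ odd b
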